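{- Let $\alpha$ be a positive integer. Every graph $G=(V,E)$ with chromatic number at most $\alpha$ admits a partial edge colouring with $3\lceil\log_2\alpha\rceil+16$ colours that satisfies all non-isolated edges of $G$.
   Context: All graphs are simple and finite. A partial edge colouring assigns colours to some (not necessarily all) edges. For an edge $e=uv$, $E[e]$ is the set of all edges incident with $u$ or $v$ and $E(e)=E[e]\setminus\{e\}$; $e$ is isolated if $E(e)=\emptyset$. A colour $\beta$ is unique for $e$ if some $e'\in E(e)$ is coloured $\beta$ and no other edge of $E[e]\setminus\{e'\}$ is coloured $\beta$; $e$ is satisfied if such a colour exists. -}

module Defs where

open import Data.Nat using (ℕ)
open import Data.Fin using (Fin; _<_)
open import Data.Bool using (Bool; T)
open import Data.Maybe using (Maybe; just)
open import Data.Product using (Σ; ∃; ∃-syntax; _×_; _,_; proj₁; proj₂)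
open import Data.Sum using (_⊎_)
open import Relation.Binary.PropositionalEquality using (_≡_)
open import Relation.Nullary using (¬_)

record Graph (n : ℕ) : Set where
  field
    adj    : Fin n → Fin n → Bool
    sym    : ∀ u v → adj u v ≡ adj v u
    irrefl : ∀ u → ¬ T (adj u u)
open Graph public

-- An edge uv is represented once, by its endpoints with u < v.
Edge : ∀ {n} → Graph n → Set
Edge {n} G = Σ (Fin n) λ u → Σ (Fin n) λ v → (u < v) × T (adj G u v)

module _ {n : ℕ} {G : Graph n} where

  src tgt : Edge G → Fin n
  src e = proj₁ e
  tgt e = proj₁ (proj₂ e)

  SameEdge : Edge G → Edge G → Set
  SameEdge e f = (src e ≡ src f) × (tgt e ≡ tgt f)

  _∈ᵥ_ : Fin n → Edge G → Set
  x ∈ᵥ e = (x ≡ src e) ⊎ (x ≡ tgt e)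

  InClosedNbhd : Edge G → Edge G → Set
  InClosedNbhd e f = (src e ∈ᵥ f) ⊎ (tgt e ∈ᵥ f)

  InOpenNbhd : Edge G → Edge G → Set
  InOpenNbhd e f = InClosedNbhd e f × ¬ SameEdge e f

  Isolated : Edge G → Set
  Isolated e = ¬ (∃[ f ] InOpenNbhd e f)

PartialEdgeColouring : ∀ {n} → Graph n → ℕ → Set
PartialEdgeColouring G k = Edge G → Maybe (Fin k)

module _ {n : ℕ} {G : Graph n} {k : ℕ} where

  UniqueFor : PartialEdgeColouring G k → Fin k → Edge G → Set
  UniqueFor c β e =
    ∃[ e' ] (InOpenNbhd {G = G} e e' × c e' ≡ just β ×
             (∀ f → InClosedNbhd {G = G} e f → c f ≡ just β → SameEdge {G = G} f e'))

  Satisfied : PartialEdgeColouring G k → Edge G → Set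
  Satisfied c e = ∃[ β ] UniqueFor c β e

ChromaticAtMost : ∀ {n} → Graph n → ℕ → Set
ChromaticAtMost {n} G α =
  Σ (Fin n → Fin α) λ χ → (∀ (u v : Fin n) → T (adj G u v) → ¬ (χ u ≡ χ v))

{-# OPTIONS --safe #-}
module Submission where

-- Colour vertices by k = ⌈log₂ α⌉ bits and put every edge into the class of the first bit in which its
-- ends differ.  Each class is bipartite, and a bipartite graph has a partial colouring with 3 colours
-- satisfying all its non-isolated edges: take a minimal set D of branching vertices dominating the
-- neighbours of branching vertices, and give each member of D a private neighbour.  So only the edges
-- isolated in their class are left.  If two of them are adjacent, one can join the class of the other
-- (flipping the single edge there); afterwards they form a matching H.  Let uv ∈ H be adjacent to an
-- edge of the class j.  Either uv can join class j, after recolouring a component, or some uw (possibly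
-- together with vw) can be taken out of class j without isolating any edge.  In the latter case uv and
-- the edges removed are set aside; uv then carries an arrow to w, and it is satisfied by the colour of
-- uw, while uw is satisfied by the colour of uv.  An edge of H that meets an edge already set aside is
-- set aside without an arrow of its own and satisfied by a distinguished arrow ending on it.  As the
-- arrows form a forest once H is contracted, six colours suffice for the edges set aside.

open import Defs
open import Data.Nat using (ℕ; zero; suc; _+_; _*_; _∸_; _≥_; _^_; _≤_; z≤n; s≤s; ⌊_/2⌋; ⌈_/2⌉)
import Data.Nat as ℕ
import Data.Nat.Properties as ℕ
open import Data.Nat.Induction using (<-rec)
open import Data.Nat.Logarithm using (⌈log₂_⌉; ⌈log₂⌉-mono-≤; ⌈log₂⌈n/2⌉⌉≡⌈log₂n⌉∸1)
open import Data.Bool using (Bool; true; false; not; _xor_; T; if_then_else_)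
open import Data.Bool.Properties using (not-injective; not-¬; ¬-not; T?) renaming (_≟_ to _≟ᵇ_)
open import Data.Fin using (Fin; zero; suc; _≟_; join; splitAt; combine; finToFun; funToFin; inject≤)
open import Data.Fin.Patterns using (0F; 1F; 2F; 3F; 4F; 5F)
open import Data.Fin.Properties
  using (any?; all?; ¬∀⟶∃¬; _<?_; <-cmp; <-asym; splitAt-join; combine-injective;
         funToFin-finToFin; inject≤-injective)
open import Data.List using (List; []; _∷_; allFin; cartesianProduct)
open import Data.List.Membership.Propositional using (_∈_)
open import Data.List.Membership.Propositional.Properties using (∈-allFin; ∈-cartesianProduct⁺)
open import Data.List.Relation.Unary.Any using (here; there)
open import Data.Maybe as Maybe using (Maybe; just; nothing)
open import Data.Maybe.Properties using (just-injective; ≡-dec)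
open import Data.Product using (Σ; ∃; ∃-syntax; _×_; _,_; proj₁; proj₂; uncurry)
open import Data.Sum as Sum using (_⊎_; inj₁; inj₂; swap)
open import Data.Sum.Properties using (inj₁-injective; inj₂-injective)
open import Level using (Level)
open import Relation.Binary.Definitions using (tri<; tri≈; tri>)
open import Relation.Binary.PropositionalEquality as ≡ using (_≡_; _≢_; refl)
open import Relation.Nullary using (¬_; Dec; yes; no; does; contradiction)
open import Relation.Nullary.Decidable using (_×-dec_; _⊎-dec_; _→-dec_; ¬?; decidable-stable)

-- Relations on the vertices, isolated edges and satisfaction.

private variable
  n : ℕ
  C : Set

Rel : ℕ → Set₁
Rel n = Fin n → Fin n → Set

SamePair : (x y a b : Fin n) → Set
SamePair x y a b = (x ≡ a × y ≡ b) ⊎ (x ≡ b × y ≡ a)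

samePair? : (x y a b : Fin n) → Dec (SamePair x y a b)
samePair? x y a b = (x ≟ a) ×-dec (y ≟ b) ⊎-dec (x ≟ b) ×-dec (y ≟ a)

SamePair-swap : {x y a b : Fin n} → SamePair x y a b → SamePair y x a b
SamePair-swap (inj₁ (p , q)) = inj₂ (q , p)
SamePair-swap (inj₂ (p , q)) = inj₁ (q , p)

SamePair-swapʳ : {x y a b : Fin n} → SamePair x y a b → SamePair x y b a
SamePair-swapʳ = swap

IsolatedIn : Rel n → Rel n
IsolatedIn S x y = S x y × (∀ z → S x z → z ≡ y) × (∀ z → S y z → z ≡ x)

HasNeighbour : Rel n → Rel n
HasNeighbour S x y = ∃[ z ] ((S x z × z ≢ y) ⊎ (S y z × z ≢ x))

module _ {S : Rel n} (S? : ∀ x y → Dec (S x y)) where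

  isolatedIn? : ∀ x y → Dec (IsolatedIn S x y)
  isolatedIn? x y = S? x y ×-dec all? (λ z → S? x z →-dec (z ≟ y))
                           ×-dec all? (λ z → S? y z →-dec (z ≟ x))

  hasNeighbour? : ∀ x y → Dec (HasNeighbour S x y)
  hasNeighbour? x y = any? λ z → (S? x z ×-dec ¬? (z ≟ y)) ⊎-dec (S? y z ×-dec ¬? (z ≟ x))

  ¬isolated⇒neighbour : ∀ {x y} → S x y → ¬ IsolatedIn S x y → HasNeighbour S x y
  ¬isolated⇒neighbour {x} {y} sxy ¬iso with hasNeighbour? x y
  ... | yes p = p
  ... | no ¬p = contradiction
    (sxy , (λ z s → decidable-stable (z ≟ y) λ z≢y → ¬p (z , inj₁ (s , z≢y)))
         , (λ z s → decidable-stable (z ≟ x) λ z≢x → ¬p (z , inj₂ (s , z≢x)))) ¬iso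

isolatedIn-swap : {S : Rel n} → (∀ {x y} → S x y → S y x) →
                  ∀ {x y} → IsolatedIn S x y → IsolatedIn S y x
isolatedIn-swap S-sym (s , p , q) = S-sym s , q , p

-- The unique edge is given as ab with a the endpoint shared with xy.
record SatisfiedIn (S : Rel n) (c : Fin n → Fin n → Maybe C) (x y : Fin n) : Set where
  field
    a b     : Fin n
    colour  : C
    shared  : a ≡ x ⊎ a ≡ y
    edge    : S a b
    other   : ¬ SamePair a b x y
    painted : c a b ≡ just colour
    unique  : ∀ a′ b′ → a′ ≡ x ⊎ a′ ≡ y → S a′ b′ → c a′ b′ ≡ just colour → SamePair a′ b′ a b

satisfiedIn-swap : {S : Rel n} {c : Fin n → Fin n → Maybe C} {x y : Fin n} →
                   SatisfiedIn S c x y → SatisfiedIn S c y x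
satisfiedIn-swap sat = record
  { shared = swap shared ; edge = edge ; other = λ s → other (SamePair-swapʳ s)
  ; painted = painted ; unique = λ a′ b′ sh → unique a′ b′ (swap sh) }
  where open SatisfiedIn sat

-- Choosing vertices, and repairing defects one after the other.

pick : {P : Fin n → Set} → (∀ x → Dec (P x)) → Maybe (Fin n)
pick P? with any? P?
... | yes (x , _) = just x
... | no _        = nothing

module _ {P : Fin n → Set} (P? : ∀ x → Dec (P x)) where

  pick-sound : ∀ {x} → pick P? ≡ just x → P x
  pick-sound eq with any? P?
  pick-sound refl | yes (_ , p) = p

  pick-complete : ∀ {x} → P x → ∃[ y ] (pick P? ≡ just y)
  pick-complete {x} p with any? P?
  ... | yes (y , _) = y , refl
  ... | no ¬p       = contradiction (x , p) ¬p

-- A single pass suffices because a step creates no bad index, so what has been repaired stays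
-- repaired. The universe of the states is arbitrary because dominating sets carry a predicate.
sweep : {ℓ : Level} {S : Set ℓ} {I : Set} (Bad : S → I → Set) →
        (∀ s i → Σ S λ s′ → ¬ Bad s′ i × (∀ j → Bad s′ j → Bad s j)) →
        (xs : List I) (s : S) →
        Σ S λ s′ → (∀ i → i ∈ xs → ¬ Bad s′ i) × (∀ j → Bad s′ j → Bad s j)
sweep Bad step []       s = s , (λ _ ()) , λ _ b → b
sweep Bad step (x ∷ xs) s with step s x
... | s₁ , ok , mono with sweep Bad step xs s₁
... | s₂ , oks , mono₂ = s₂ , (λ { i (here refl) b → ok (mono₂ i b) ; i (there m) → oks i m })
                            , λ j b → mono j (mono₂ j b)

sweepPairs : {S : Set} (Bad : S → Fin n → Fin n → Set) →
             (∀ s x y → Σ S λ s′ → ¬ Bad s′ x y × (∀ u v → Bad s′ u v → Bad s u v)) →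
             S → Σ S λ s → ∀ x y → ¬ Bad s x y
sweepPairs {n = n} Bad step s
  with sweep (λ s (x , y) → Bad s x y)
             (λ s (x , y) → let s′ , ok , mono = step s x y in s′ , ok , λ (u , v) → mono u v)
             (cartesianProduct (allFin n) (allFin n)) s
... | s′ , ok , _ = s′ , λ x y → ok (x , y) (∈-cartesianProduct⁺ (∈-allFin x) (∈-allFin y))

_≟ₘ_ : (x y : Maybe (Fin n)) → Dec (x ≡ y)
_≟ₘ_ = ≡-dec _≟_

just-unique : {m : Maybe C} {x y : C} → m ≡ just x → m ≡ just y → x ≡ y
just-unique p q = just-injective (≡.trans (≡.sym p) q)

-- Three colours for the non-isolated edges of a bipartite graph.

module BipartiteColouring
  (S : Rel n) (S? : ∀ x y → Dec (S x y)) (S-sym : ∀ {x y} → S x y → S y x)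
  (side : Fin n → Bool) (proper : ∀ {x y} → S x y → side x ≢ side y) where

  Branching : Fin n → Set
  Branching a = ∃[ b ] ∃[ b′ ] (S a b × S a b′ × b ≢ b′)

  branching? : ∀ a → Dec (Branching a)
  branching? a = any? λ b → any? λ b′ → S? a b ×-dec S? a b′ ×-dec ¬? (b ≟ b′)

  -- All neighbours of a vertex outside the core have degree one, so such a vertex is the centre of
  -- a star.
  Core : Fin n → Set
  Core b = ∃[ a ] (S a b × Branching a)

  core? : ∀ b → Dec (Core b)
  core? b = any? λ a → S? a b ×-dec branching? a

  record Dominating : Set₁ where
    field
      D         : Fin n → Set
      D?        : ∀ a → Dec (D a)
      branching : ∀ {a} → D a → Branching a
      covers    : ∀ {b} → Core b → ∃[ a ] (D a × S a b)

  Redundant : Dominating → Fin n → Set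
  Redundant X d = D d × (∀ b → S d b → ∃[ a ] (a ≢ d × D a × S a b))
    where open Dominating X

  redundant? : ∀ X d → Dec (Redundant X d)
  redundant? X d = D? d ×-dec all? λ b → S? d b →-dec any? λ a → ¬? (a ≟ d) ×-dec D? a ×-dec S? a b
    where open Dominating X

  remove : ∀ X d → Redundant X d → Dominating
  remove X d (_ , red) = record
    { D         = λ a → D a × a ≢ d
    ; D?        = λ a → D? a ×-dec ¬? (a ≟ d)
    ; branching = λ (p , _) → branching p
    ; covers    = cov
    }
    where
    open Dominating X
    cov : ∀ {b} → Core b → ∃[ a ] ((D a × a ≢ d) × S a b)
    cov {b} core with covers core
    ... | a , da , sab with a ≟ d
    ...   | no a≢d   = a , (da , a≢d) , sab
    ...   | yes refl = let a′ , a′≢d , da′ , sa′b = red b sab in a′ , (da′ , a′≢d) , sa′b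

  -- Starting from all branching vertices, redundant ones are discarded. A vertex redundant after a
  -- removal was redundant before it, so one sweep is enough.
  minimalDominating : Σ Dominating λ X → ∀ d → ¬ Redundant X d
  minimalDominating with sweep Redundant step (allFin n) (record
    { D = Branching ; D? = branching? ; branching = λ p → p ; covers = λ (a , s , p) → a , p , s })
    where
    step : ∀ X d → Σ Dominating λ X′ → ¬ Redundant X′ d × (∀ e → Redundant X′ e → Redundant X e)
    step X d with redundant? X d
    ... | no ¬r = X , ¬r , λ _ r → r
    ... | yes r = remove X d r , (λ ((_ , d≢d) , _) → d≢d refl)
                , λ e ((de , _) , f) → de , λ b s → let a , a≢e , (da , _) , sab = f b s
                                                    in a , a≢e , da , sab
  ... | X , ok , _ = X , λ d → ok d (∈-allFin d)

  module WithMinimal (X : Dominating) (minimal : ∀ d → ¬ Redundant X d) where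
    open Dominating X

    Private : Fin n → Fin n → Set
    Private d b = S d b × (∀ a → D a → S a b → a ≡ d)

    private? : ∀ d b → Dec (Private d b)
    private? d b = S? d b ×-dec all? λ a → D? a →-dec S? a b →-dec (a ≟ d)

    -- Otherwise every neighbour of `d` would be covered by another member of `D`, and `d` would be
    -- redundant.
    hasPrivate : ∀ {d} → D d → ∃[ b ] Private d b
    hasPrivate {d} dd
      with b , ¬p ← ¬∀⟶∃¬ n _ (λ b → S? d b →-dec any? λ a → ¬? (a ≟ d) ×-dec D? a ×-dec S? a b)
                           (λ f → minimal d (dd , f))
      = b , decidable-stable (S? d b) (λ ¬s → ¬p λ s → contradiction s ¬s)
          , λ a da sab → decidable-stable (a ≟ d) λ a≢d → ¬p λ _ → a , a≢d , da , sab

    -- `own b` is the owner of `b`, and `alt d` is a second neighbour of `d` besides `priv d`.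
    -- Neighbours owned by `d` come first: if `alt d` is not owned by `d`, then `d` owns nothing
    -- except possibly `priv d`.
    priv own alt : Fin n → Maybe (Fin n)
    priv d = pick (private? d)
    own  b = pick λ a → D? a ×-dec S? a b

    ownedOther? : ∀ d b → Dec (S d b × own b ≡ just d × priv d ≢ just b)
    ownedOther? d b = S? d b ×-dec (own b ≟ₘ just d) ×-dec ¬? (priv d ≟ₘ just b)

    other? : ∀ d b → Dec (S d b × priv d ≢ just b)
    other? d b = S? d b ×-dec ¬? (priv d ≟ₘ just b)

    alt d with any? (ownedOther? d)
    ... | yes (b , _) = just b
    ... | no _        = pick (other? d)

    alt-sound : ∀ {d b} → alt d ≡ just b → S d b × priv d ≢ just b
    alt-sound {d} eq with any? (ownedOther? d)
    alt-sound refl | yes (_ , s , _ , p) = s , p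
    ... | no _ = pick-sound (other? d) eq

    alt-owned : ∀ {d b b′} → alt d ≡ just b → own b ≢ just d → S d b′ →
                own b′ ≡ just d → priv d ≡ just b′
    alt-owned {d} {b′ = b′} eq nown s o with any? (ownedOther? d)
    alt-owned refl nown s o | yes (_ , _ , o′ , _) = contradiction o′ nown
    ... | no ¬p = decidable-stable (priv d ≟ₘ just b′) λ np → ¬p (b′ , s , o , np)

    alt-complete : ∀ {d} → D d → ∃[ b ] (alt d ≡ just b)
    alt-complete {d} dd with any? (ownedOther? d)
    ... | yes (b , _) = b , refl
    ... | no _ with branching dd
    ...   | b , b′ , sb , sb′ , b≢b′ with priv d ≟ₘ just b
    ...     | no np = pick-complete (other? d) (sb , np)
    ...     | yes p = pick-complete (other? d) (sb′ , λ p′ → b≢b′ (just-unique p p′))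

    priv-complete : ∀ {d} → D d → ∃[ b ] (priv d ≡ just b)
    priv-complete {d} dd = let _ , p = hasPrivate dd in pick-complete (private? d) p

    own-sound : ∀ {b a} → own b ≡ just a → D a × S a b
    own-sound {b} = pick-sound λ a → D? a ×-dec S? a b

    own-complete : ∀ {b} → Core b → ∃[ a ] (own b ≡ just a)
    own-complete {b} core = let _ , p = covers core in pick-complete (λ a → D? a ×-dec S? a b) p

    priv-sound : ∀ {d b} → priv d ≡ just b → Private d b
    priv-sound {d} = pick-sound (private? d)

    leaf₁ leaf₂ : Fin n → Maybe (Fin n)
    leaf₁ b = pick (S? b)
    leaf₂ b = pick λ a → S? b a ×-dec ¬? (leaf₁ b ≟ₘ just a)

    -- The owner's edge at b is painted 2F or 1F according to whether alt of the owner is b.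
    OwnedByAlt : Fin n → Set
    OwnedByAlt b = ∃[ d ] (own b ≡ just d × alt d ≡ just b)

    ownedByAlt? : ∀ b → Dec (OwnedByAlt b)
    ownedByAlt? b = any? λ d → (own b ≟ₘ just d) ×-dec (alt d ≟ₘ just b)

    -- The end `a` is meant to lie on the true side. Private edges get 0F, and an owner's other
    -- edges get 1F or 2F; an edge to `alt a` not owned by `a` takes whichever of 1F and 2F the
    -- owner's edge at `b` does not have. The colour is an index, so that matching at a given colour
    -- leaves only the rules producing it.
    data View (a b : Fin n) : Maybe (Fin 3) → Set where
      is-priv : D a → priv a ≡ just b → View a b (just 0F)
      is-own₁ : D a → priv a ≢ just b → own b ≡ just a → alt a ≢ just b → View a b (just 1F)
      is-own₂ : D a → priv a ≢ just b → own b ≡ just a → alt a ≡ just b → View a b (just 2F)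
      is-alt₁ : D a → priv a ≢ just b → own b ≢ just a → alt a ≡ just b → OwnedByAlt b → View a b (just 1F)
      is-alt₂ : D a → priv a ≢ just b → own b ≢ just a → alt a ≡ just b → ¬ OwnedByAlt b → View a b (just 2F)
      is-rest : D a → priv a ≢ just b → own b ≢ just a → alt a ≢ just b → View a b nothing
      is-core : ¬ D a → Core b → View a b nothing
      is-leaf₁ : ¬ D a → ¬ Core b → leaf₁ b ≡ just a → View a b (just 0F)
      is-leaf₂ : ¬ D a → ¬ Core b → leaf₁ b ≢ just a → leaf₂ b ≡ just a → View a b (just 1F)
      is-leaf  : ¬ D a → ¬ Core b → leaf₁ b ≢ just a → leaf₂ b ≢ just a → View a b nothing

    paint : ∀ a b → ∃ (View a b)
    paint a b with D? a
    ... | yes da with priv a ≟ₘ just b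
    ...   | yes p = _ , is-priv da p
    ...   | no ¬p with own b ≟ₘ just a | alt a ≟ₘ just b
    ...     | yes o | yes t = _ , is-own₂ da ¬p o t
    ...     | yes o | no ¬t = _ , is-own₁ da ¬p o ¬t
    ...     | no ¬o | no ¬t = _ , is-rest da ¬p ¬o ¬t
    ...     | no ¬o | yes t with ownedByAlt? b
    ...       | yes w = _ , is-alt₁ da ¬p ¬o t w
    ...       | no ¬w = _ , is-alt₂ da ¬p ¬o t ¬w
    paint a b | no ¬da with core? b
    ...   | yes core = _ , is-core ¬da core
    ...   | no ¬core with leaf₁ b ≟ₘ just a | leaf₂ b ≟ₘ just a
    ...     | yes p | _     = _ , is-leaf₁ ¬da ¬core p
    ...     | no ¬p | yes q = _ , is-leaf₂ ¬da ¬core ¬p q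
    ...     | no ¬p | no ¬q = _ , is-leaf ¬da ¬core ¬p ¬q

    col : Fin n → Fin n → Maybe (Fin 3)
    col a b = proj₁ (paint a b)

    view : ∀ a b {m} → col a b ≡ m → View a b m
    view a b refl = proj₂ (paint a b)

    c : Fin n → Fin n → Maybe (Fin 3)
    c x y = if side x then col x y else col y x

    c-sym : ∀ {x y} → S x y → c x y ≡ c y x
    c-sym {x} {y} s with side x | side y | proper s
    ... | true  | true  | ne = contradiction refl ne
    ... | true  | false | _  = refl
    ... | false | true  | _  = refl
    ... | false | false | ne = contradiction refl ne

    -- Satisfaction of an edge ab whose first endpoint lies on the true side.
    Satisfied→ : Fin n → Fin n → Set
    Satisfied→ a b = ∃[ a′ ] ∃[ b′ ] ∃[ γ ]
      ((a′ ≡ a ⊎ b′ ≡ b) × S a′ b′ × ¬ (a′ ≡ a × b′ ≡ b) × col a′ b′ ≡ just γ ×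
       (∀ p q → p ≡ a ⊎ q ≡ b → S p q → col p q ≡ just γ → p ≡ a′ × q ≡ b′))

    core-of : ∀ {a b} → D a → S a b → Core b
    core-of da s = _ , s , branching da

    D-priv-own : ∀ {a b d} → D a → S a b → priv d ≡ just b → a ≡ d
    D-priv-own da s p = proj₂ (priv-sound p) _ da s

    col-priv : ∀ {a b} → D a → priv a ≡ just b → col a b ≡ just 0F
    col-priv {a} {b} da p with col a b | view a b refl
    ... | _ | is-priv _ _         = refl
    ... | _ | is-own₁ _ ¬p _ _    = contradiction p ¬p
    ... | _ | is-own₂ _ ¬p _ _    = contradiction p ¬p
    ... | _ | is-alt₁ _ ¬p _ _ _  = contradiction p ¬p
    ... | _ | is-alt₂ _ ¬p _ _ _  = contradiction p ¬p
    ... | _ | is-rest _ ¬p _ _    = contradiction p ¬p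
    ... | _ | is-core ¬d _        = contradiction da ¬d
    ... | _ | is-leaf₁ ¬d _ _     = contradiction da ¬d
    ... | _ | is-leaf₂ ¬d _ _ _   = contradiction da ¬d
    ... | _ | is-leaf ¬d _ _ _    = contradiction da ¬d

    -- The private edge of `a` is the witness, being the only edge at `a` with colour 0F. An edge at
    -- `b` with colour 0F would be the private edge of a member of `D`, which could only be `a`
    -- itself.
    satisfied-nonprivate : ∀ {a b} → D a → S a b → priv a ≢ just b → Satisfied→ a b
    satisfied-nonprivate {a} {b} da s ¬p with priv-complete da
    ... | b₀ , p₀ = a , b₀ , 0F , inj₁ refl , proj₁ (priv-sound p₀)
                  , (λ { (_ , refl) → ¬p p₀ }) , col-priv da p₀ , unique
      where
      unique : ∀ x y → x ≡ a ⊎ y ≡ b → S x y → col x y ≡ just 0F → x ≡ a × y ≡ b₀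
      unique x y sh sxy eq with view x y eq
      unique x y (inj₁ refl) sxy eq | is-priv _ p = refl , just-unique p p₀
      unique x y (inj₂ refl) sxy eq | is-priv _ p =
        contradiction (≡.subst (λ z → priv z ≡ just b) (≡.sym (D-priv-own da s p)) p) ¬p
      unique x y (inj₁ refl) sxy eq | is-leaf₁ ¬d _ _ = contradiction da ¬d
      unique x y (inj₂ refl) sxy eq | is-leaf₁ _ ¬c _ = contradiction (core-of da s) ¬c

    -- The witness goes from `a` to `alt a`. As `b` meets no member of `D` but `a`, only edges at
    -- `a` compete. If `a` owns `alt a`, the colour is 2F, which occurs once at `a`; if not, `a`
    -- owns no neighbour except possibly `b`, so nothing else at `a` has colour 1F or 2F.
    satisfied-private : ∀ {a b} → D a → S a b → priv a ≡ just b → Satisfied→ a b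
    satisfied-private {a} {b} da s p with alt-complete da
    ... | b₁ , t with alt-sound t
    ... | s₁ , ¬p₁ = witness _ refl (view a b₁ refl)
      where
      at-a : ∀ {x y γ} → x ≡ a ⊎ y ≡ b → S x y → View x y (just γ) → γ ≢ 0F → x ≡ a
      at-a (inj₁ e) _ _ _ = e
      at-a (inj₂ refl) sxy (is-priv _ _) ne = contradiction refl ne
      at-a (inj₂ refl) sxy (is-own₁ d _ _ _) _ = D-priv-own d sxy p
      at-a (inj₂ refl) sxy (is-own₂ d _ _ _) _ = D-priv-own d sxy p
      at-a (inj₂ refl) sxy (is-alt₁ d _ _ _ _) _ = D-priv-own d sxy p
      at-a (inj₂ refl) sxy (is-alt₂ d _ _ _ _) _ = D-priv-own d sxy p
      at-a (inj₂ refl) sxy (is-leaf₁ _ ¬c _) _ = contradiction (core-of da s) ¬c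
      at-a (inj₂ refl) sxy (is-leaf₂ _ ¬c _ _) _ = contradiction (core-of da s) ¬c
      at-b₁ : ∀ {y γ} → S a y → View a y (just γ) → γ ≢ 0F → own b₁ ≢ just a ⊎ γ ≡ 2F → y ≡ b₁
      at-b₁ _ (is-priv _ _) ne _ = contradiction refl ne
      at-b₁ say (is-own₁ _ ¬py o _) _ (inj₁ ¬o₁) = contradiction (alt-owned t ¬o₁ say o) ¬py
      at-b₁ _ (is-own₂ _ _ _ ty) _ _ = just-unique ty t
      at-b₁ _ (is-alt₁ _ _ _ ty _) _ _ = just-unique ty t
      at-b₁ _ (is-alt₂ _ _ _ ty _) _ _ = just-unique ty t
      at-b₁ _ (is-leaf₁ ¬d _ _) _ _ = contradiction da ¬d
      at-b₁ _ (is-leaf₂ ¬d _ _ _) _ _ = contradiction da ¬d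
      build : ∀ {γ} → col a b₁ ≡ just γ → γ ≢ 0F → own b₁ ≢ just a ⊎ γ ≡ 2F → Satisfied→ a b
      build {γ} eq ne h = a , b₁ , γ , inj₁ refl , s₁ , (λ { (_ , refl) → ¬p₁ p }) , eq , unique
        where
        unique : ∀ x y → x ≡ a ⊎ y ≡ b → S x y → col x y ≡ just γ → x ≡ a × y ≡ b₁
        unique x y sh sxy eq′ with at-a sh sxy (view x y eq′) ne
        ... | refl = refl , at-b₁ sxy (view x y eq′) ne h
      witness : ∀ m → col a b₁ ≡ m → View a b₁ m → Satisfied→ a b
      witness _ _  (is-priv _ p₁)       = contradiction p₁ ¬p₁
      witness _ _  (is-own₁ _ _ _ ¬t)   = contradiction t ¬t
      witness _ eq (is-own₂ _ _ _ _)    = build eq (λ ()) (inj₂ refl)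
      witness _ eq (is-alt₁ _ _ ¬o _ _) = build eq (λ ()) (inj₁ ¬o)
      witness _ eq (is-alt₂ _ _ ¬o _ _) = build eq (λ ()) (inj₁ ¬o)
      witness _ _  (is-rest _ _ _ ¬t)   = contradiction t ¬t
      witness _ _  (is-core ¬d _)       = contradiction da ¬d
      witness _ _  (is-leaf₁ ¬d _ _)    = contradiction da ¬d
      witness _ _  (is-leaf₂ ¬d _ _ _)  = contradiction da ¬d
      witness _ _  (is-leaf ¬d _ _ _)   = contradiction da ¬d

    -- The owner's edge at `b` is the witness. No edge at `a` is painted: with a further neighbour
    -- `a` is branching, so all its neighbours are in the core, while `a` is not in `D`. At `b`, the
    -- choice between 1F and 2F keeps the alternative edges apart from the owner's.
    satisfied-core : ∀ {a b} → ¬ D a → Core b → S a b → Satisfied→ a b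
    satisfied-core {a} {b} ¬da core s with own-complete core
    ... | o , ob with own-sound ob
    ... | d-o , so = witness _ refl (view o b refl)
      where
      at-b : ∀ {x y γ} → x ≡ a ⊎ y ≡ b → S x y → View x y (just γ) → y ≡ b × D x
      at-b (inj₁ refl) sxy (is-priv d _) = contradiction d ¬da
      at-b (inj₁ refl) sxy (is-own₁ d _ _ _) = contradiction d ¬da
      at-b (inj₁ refl) sxy (is-own₂ d _ _ _) = contradiction d ¬da
      at-b (inj₁ refl) sxy (is-alt₁ d _ _ _ _) = contradiction d ¬da
      at-b (inj₁ refl) sxy (is-alt₂ d _ _ _ _) = contradiction d ¬da
      at-b (inj₁ refl) sxy (is-leaf₁ _ ¬c _) = contradiction
        (a , sxy , b , _ , s , sxy , λ { refl → ¬c core }) ¬c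
      at-b (inj₁ refl) sxy (is-leaf₂ _ ¬c _ _) = contradiction
        (a , sxy , b , _ , s , sxy , λ { refl → ¬c core }) ¬c
      at-b (inj₂ refl) sxy (is-priv d _) = refl , d
      at-b (inj₂ refl) sxy (is-own₁ d _ _ _) = refl , d
      at-b (inj₂ refl) sxy (is-own₂ d _ _ _) = refl , d
      at-b (inj₂ refl) sxy (is-alt₁ d _ _ _ _) = refl , d
      at-b (inj₂ refl) sxy (is-alt₂ d _ _ _ _) = refl , d
      at-b (inj₂ refl) sxy (is-leaf₁ _ ¬c _) = contradiction core ¬c
      at-b (inj₂ refl) sxy (is-leaf₂ _ ¬c _ _) = contradiction core ¬c
      build : ∀ {γ} → col o b ≡ just γ → (∀ {x} → D x → S x b → View x b (just γ) → x ≡ o) →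
              Satisfied→ a b
      build {γ} eq f = o , b , γ , inj₂ refl , so , (λ { (refl , _) → ¬da d-o }) , eq , unique
        where
        unique : ∀ x y → x ≡ a ⊎ y ≡ b → S x y → col x y ≡ just γ → x ≡ o × y ≡ b
        unique x y sh sxy eq′ with at-b sh sxy (view x y eq′)
        ... | refl , dx = f dx sxy (view x y eq′) , refl
      witness : ∀ m → col o b ≡ m → View o b m → Satisfied→ a b
      witness _ eq (is-priv _ p) = build eq λ dx sx _ → D-priv-own dx sx p
      witness _ eq (is-own₁ _ ¬p _ ¬t) = build eq λ where
        _ _ (is-own₁ _ _ ox _) → just-unique ox ob
        _ _ (is-alt₁ _ _ _ _ (d , od , td)) →
          contradiction (≡.subst (λ z → alt z ≡ just b) (just-unique od ob) td) ¬t
        _ _ (is-leaf₂ _ ¬c _ _) → contradiction core ¬c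
      witness _ eq (is-own₂ _ ¬p _ t) = build eq λ where
        _ _ (is-own₂ _ _ ox _) → just-unique ox ob
        _ _ (is-alt₂ _ _ _ _ ¬w) → contradiction (o , ob , t) ¬w
      witness _ _ (is-alt₁ _ _ ¬o _ _) = contradiction ob ¬o
      witness _ _ (is-alt₂ _ _ ¬o _ _) = contradiction ob ¬o
      witness _ _ (is-rest _ _ ¬o _)   = contradiction ob ¬o
      witness _ _ (is-core ¬d _)       = contradiction d-o ¬d
      witness _ _ (is-leaf₁ ¬d _ _)    = contradiction d-o ¬d
      witness _ _ (is-leaf₂ ¬d _ _ _)  = contradiction d-o ¬d
      witness _ _ (is-leaf ¬d _ _ _)   = contradiction d-o ¬d

    -- Here `b` is the centre of a star. The witness is the edge to `leaf₁ b`, or the one to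
    -- `leaf₂ b` if `a` is `leaf₁ b`.
    satisfied-star : ∀ {a b} → ¬ Core b → S a b → HasNeighbour S a b → Satisfied→ a b
    satisfied-star {a} {b} ¬core s (z , inj₁ (sz , z≢b)) =
      contradiction (a , s , z , b , sz , s , z≢b) ¬core
    satisfied-star {a} {b} ¬core s (z , inj₂ (sz , z≢a)) = result
      where
      at-b : ∀ {x y} → x ≡ a ⊎ y ≡ b → S x y → y ≡ b
      at-b (inj₂ e) _ = e
      at-b {y = y} (inj₁ refl) say = decidable-stable (y ≟ b) λ y≢b →
        ¬core (a , s , y , b , say , s , y≢b)
      ¬D : ∀ {x} → S x b → ¬ D x
      ¬D sx d = ¬core (core-of d sx)
      leaf₂? = λ x → S? b x ×-dec ¬? (leaf₁ b ≟ₘ just x)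
      l₁ : ∃[ x ] (leaf₁ b ≡ just x)
      l₁ = pick-complete (S? b) sz
      l₂ : ∃[ x ] (leaf₂ b ≡ just x)
      l₂ with leaf₁ b ≟ₘ just z
      ... | no ¬e = pick-complete leaf₂? (sz , ¬e)
      ... | yes e = pick-complete leaf₂? (S-sym s , λ e′ → z≢a (just-unique e e′))
      col₁ : ∀ {x} → leaf₁ b ≡ just x → S x b → col x b ≡ just 0F
      col₁ {x} e sx with col x b | view x b refl
      ... | _ | is-leaf₁ _ _ _ = refl
      ... | _ | is-leaf₂ _ _ ¬e _ = contradiction e ¬e
      ... | _ | is-leaf _ _ ¬e _ = contradiction e ¬e
      ... | _ | is-core _ cb = contradiction cb ¬core
      ... | _ | is-priv d _ = contradiction d (¬D sx)
      ... | _ | is-own₁ d _ _ _ = contradiction d (¬D sx)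
      ... | _ | is-own₂ d _ _ _ = contradiction d (¬D sx)
      ... | _ | is-alt₁ d _ _ _ _ = contradiction d (¬D sx)
      ... | _ | is-alt₂ d _ _ _ _ = contradiction d (¬D sx)
      ... | _ | is-rest d _ _ _ = contradiction d (¬D sx)
      col₂ : ∀ {x} → leaf₂ b ≡ just x → S x b → col x b ≡ just 1F
      col₂ {x} e sx with col x b | view x b refl
      ... | _ | is-leaf₁ _ _ e₁ = contradiction e₁ (proj₂ (pick-sound leaf₂? e))
      ... | _ | is-leaf₂ _ _ _ _ = refl
      ... | _ | is-leaf _ _ _ ¬e = contradiction e ¬e
      ... | _ | is-core _ cb = contradiction cb ¬core
      ... | _ | is-priv d _ = contradiction d (¬D sx)
      ... | _ | is-own₁ d _ _ _ = contradiction d (¬D sx)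
      ... | _ | is-own₂ d _ _ _ = contradiction d (¬D sx)
      ... | _ | is-alt₁ d _ _ _ _ = contradiction d (¬D sx)
      ... | _ | is-alt₂ d _ _ _ _ = contradiction d (¬D sx)
      ... | _ | is-rest d _ _ _ = contradiction d (¬D sx)
      result : Satisfied→ a b
      result with l₁ | l₂
      ... | x₁ , e₁ | x₂ , e₂ with S-sym (pick-sound (S? b) e₁) | pick-sound leaf₂? e₂ | x₁ ≟ a
      ...   | s₁ | s₂ , ¬e₁ | no x₁≢a =
        x₁ , b , 0F , inj₂ refl , s₁ , (λ (p , _) → x₁≢a p) , col₁ e₁ s₁ , unique
        where
        unique : ∀ x y → x ≡ a ⊎ y ≡ b → S x y → col x y ≡ just 0F → x ≡ x₁ × y ≡ b
        unique x y sh sxy eq with at-b sh sxy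
        ... | refl with view x b eq
        ...   | is-priv d _ = contradiction d (¬D sxy)
        ...   | is-leaf₁ _ _ e = just-unique e e₁ , refl
      ...   | s₁ | s₂ , ¬e₁ | yes refl =
        x₂ , b , 1F , inj₂ refl , S-sym s₂ , (λ { (refl , _) → ¬e₁ e₁ }) , col₂ e₂ (S-sym s₂) , unique
        where
        unique : ∀ x y → x ≡ a ⊎ y ≡ b → S x y → col x y ≡ just 1F → x ≡ x₂ × y ≡ b
        unique x y sh sxy eq with at-b sh sxy
        ... | refl with view x b eq
        ...   | is-own₁ d _ _ _ = contradiction d (¬D sxy)
        ...   | is-alt₁ d _ _ _ _ = contradiction d (¬D sxy)
        ...   | is-leaf₂ _ _ _ e = just-unique e e₂ , refl

    satisfied→ : ∀ {a b} → S a b → HasNeighbour S a b → Satisfied→ a b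
    satisfied→ {a} {b} s nb with D? a
    ... | yes da with priv a ≟ₘ just b
    ...   | yes p = satisfied-private da s p
    ...   | no ¬p = satisfied-nonprivate da s ¬p
    satisfied→ {a} {b} s nb | no ¬da with core? b
    ...   | yes core = satisfied-core ¬da core s
    ...   | no ¬core = satisfied-star ¬core s nb

    c-true : ∀ {x y} → side x ≡ true → c x y ≡ col x y
    c-true e rewrite e = refl

    c-false : ∀ {x y} → side x ≡ false → c x y ≡ col y x
    c-false e rewrite e = refl

    side-flip : ∀ {x y} → S x y → side x ≡ true → side y ≡ false
    side-flip {x} {y} s e with side y in ey
    ... | false = refl
    ... | true  = contradiction (≡.trans e (≡.sym ey)) (proper s)

    side-flop : ∀ {x y} → S x y → side x ≡ false → side y ≡ true
    side-flop {x} {y} s e with side y in ey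
    ... | true  = refl
    ... | false = contradiction (≡.trans e (≡.sym ey)) (proper s)

    satisfied-true : ∀ {a b} → side a ≡ true → S a b → HasNeighbour S a b → SatisfiedIn S c a b
    satisfied-true {a} {b} ta sab nb with satisfied→ sab nb
    ... | a₀ , b₀ , γ , sh , s₀ , other , eq , unique with sh
    ...   | inj₁ refl = record
      { a = a ; b = b₀ ; shared = inj₁ refl ; edge = s₀
      ; other = λ { (inj₁ (_ , p)) → other (refl , p)
                  ; (inj₂ (refl , _)) → proper sab refl }
      ; painted = ≡.trans (c-true ta) eq
      ; unique = unique′ }
      where
      unique′ : ∀ x y → x ≡ a ⊎ x ≡ b → S x y → c x y ≡ just γ → SamePair x y a b₀
      unique′ x y (inj₁ refl) sxy e = inj₁ (unique x y (inj₁ refl) sxy (≡.trans (≡.sym (c-true ta)) e))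
      unique′ x y (inj₂ refl) sxy e = SamePair-swap (inj₁ (unique y x (inj₂ refl) (S-sym sxy)
        (≡.trans (≡.sym (c-false (side-flip sab ta))) e)))
    ...   | inj₂ refl = record
      { a = b ; b = a₀ ; shared = inj₂ refl ; edge = S-sym s₀
      ; other = λ { (inj₁ (refl , _)) → proper sab refl
                  ; (inj₂ (_ , p)) → other (p , refl) }
      ; painted = ≡.trans (c-false (side-flip sab ta)) eq
      ; unique = unique′ }
      where
      unique′ : ∀ x y → x ≡ a ⊎ x ≡ b → S x y → c x y ≡ just γ → SamePair x y b a₀
      unique′ x y (inj₁ refl) sxy e = SamePair-swapʳ (inj₁ (unique x y (inj₁ refl) sxy
        (≡.trans (≡.sym (c-true ta)) e)))
      unique′ x y (inj₂ refl) sxy e = SamePair-swapʳ (SamePair-swap (inj₁ (unique y x (inj₂ refl) (S-sym sxy)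
        (≡.trans (≡.sym (c-false (side-flip sab ta))) e))))

    hasNeighbour-swap : ∀ {x y} → HasNeighbour S x y → HasNeighbour S y x
    hasNeighbour-swap (z , h) = z , swap h

    satisfied : ∀ {a b} → S a b → HasNeighbour S a b → SatisfiedIn S c a b
    satisfied {a} {b} s nb with side a in eq
    ... | true  = satisfied-true eq s nb
    ... | false = satisfiedIn-swap (satisfied-true (side-flop s eq) (S-sym s) (hasNeighbour-swap nb))

bipartite-colouring :
  (S : Rel n) (S? : ∀ x y → Dec (S x y)) (S-sym : ∀ {x y} → S x y → S y x) →
  (side : Fin n → Bool) (proper : ∀ {x y} → S x y → side x ≢ side y) →
  ∃[ c ] ((∀ {x y} → S x y → c x y ≡ c y x) ×
          (∀ {x y} → S x y → HasNeighbour S x y → SatisfiedIn {C = Fin 3} S c x y))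
bipartite-colouring S S? S-sym side proper with minimalDominating
  where open BipartiteColouring S S? S-sym side proper
... | X , minimal = c , c-sym , satisfied
  where open BipartiteColouring.WithMinimal S S? S-sym side proper X minimal

-- Letting an edge join a bipartite class, or detaching edges from the class.

_∖_ : Rel n → Rel n → Rel n
(S ∖ R) x y = S x y × ¬ R x y

-- What is needed for `uv` to be added to `S` while `S` stays bipartite.
Separates : Rel n → Fin n → Fin n → Set
Separates {n} S u v =
  Σ (Fin n → Bool) λ side → (∀ {x y} → S x y → side x ≢ side y) × side u ≢ side v

-- No edge leaves `P`, so the two sides may be exchanged inside `P` alone. This separates a vertex
-- of `P` from one outside that was on the same side.
module Flip {S : Rel n} (S-sym : ∀ {x y} → S x y → S y x)
  (side : Fin n → Bool) (proper : ∀ {x y} → S x y → side x ≢ side y)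
  {P : Fin n → Set} (P? : ∀ x → Dec (P x)) (closed : ∀ {x y} → S x y → P x → P y) where

  flipped : Fin n → Bool
  flipped x = does (P? x) xor side x

  flipped-proper : ∀ {x y} → S x y → flipped x ≢ flipped y
  flipped-proper {x} {y} s e with P? x | P? y
  ... | yes _ | yes _ = proper s (not-injective e)
  ... | no _  | no _  = proper s e
  ... | yes p | no ¬q = ¬q (closed s p)
  ... | no ¬p | yes q = ¬p (closed (S-sym s) q)

  flipped-separates : ∀ {u v} → P u → ¬ P v → side u ≡ side v → Separates S u v
  flipped-separates {u} {v} pu ¬pv same = flipped , flipped-proper , ends
    where
    ends : flipped u ≢ flipped v
    ends e with P? u | P? v
    ... | no ¬p | _     = ¬p pu
    ... | _     | yes p = ¬pv p
    ... | yes _ | no _  = not-¬ (≡.sym same) (≡.sym e)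

-- `R` contains `uw` and possibly `vw`. Deleting it isolates no further edge, so it can be set aside
-- together with `uv`, whose arrow then points to `w`.
record Detachable (S : Rel n) (u v : Fin n) : Set₁ where
  field
    w     : Fin n
    R     : Rel n
    R?    : ∀ x y → Dec (R x y)
    R-sym : ∀ {x y} → R x y → R y x
    R⊆S   : ∀ {x y} → R x y → S x y
    shape : ∀ {x y} → R x y → SamePair x y u w ⊎ SamePair x y v w
    main  : R u w
    w≢v   : w ≢ v
    keeps : ∀ {x y} → IsolatedIn (S ∖ R) x y → IsolatedIn S x y

module _
  {S : Rel n} (S? : ∀ x y → Dec (S x y)) (S-sym : ∀ {x y} → S x y → S y x)
  (side : Fin n → Bool) (proper : ∀ {x y} → S x y → side x ≢ side y) where

  private
    S-irrefl : ∀ {x y} → S x y → x ≢ y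
    S-irrefl s refl = proper s refl

    Without : Fin n → Fin n → Rel n
    Without p q = S ∖ λ x y → SamePair x y p q

    Damage : Fin n → Fin n → Set
    Damage p q = ∃[ x ] ∃[ y ] (IsolatedIn (Without p q) x y × ¬ IsolatedIn S x y)

    without? : ∀ p q x y → Dec (Without p q x y)
    without? p q x y = S? x y ×-dec ¬? (samePair? x y p q)

    damage? : ∀ p q → Dec (Damage p q)
    damage? p q = any? λ x → any? λ y → isolatedIn? (without? p q) x y ×-dec ¬? (isolatedIn? S? x y)

    without-sym : ∀ {p q x y} → Without p q x y → Without p q y x
    without-sym (s , ¬r) = S-sym s , λ r → ¬r (SamePair-swap r)

    -- If `pq` is an edge, then `q`, `p`, `y` is a pendant path ending in the leaf `y`, and deleting
    -- `pq` isolates `py`.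
    Stub : Fin n → Fin n → Set
    Stub p q = ∃[ y ] (y ≢ q × S p y × (∀ t → S p t → t ≡ q ⊎ t ≡ y) × (∀ t → S y t → t ≡ p))

    without-flip : ∀ {p q x y} → IsolatedIn (Without p q) x y → IsolatedIn (Without q p) x y
    without-flip ((s , ¬r) , i , j) = turn (s , ¬r) , (λ z r → i z (turn r)) , (λ z r → j z (turn r))
      where
      turn : ∀ {p q x y} → Without p q x y → Without q p x y
      turn (s , ¬r) = s , λ r → ¬r (SamePair-swapʳ r)

    isolated⇒stub : ∀ {p q y} → S p q → q ≢ y → IsolatedIn (Without p q) p y → Stub p q
    isolated⇒stub {p} {q} {y} spq q≢y ((spy , _) , isoₚ , isoᵧ) =
      y , (λ e → q≢y (≡.sym e)) , spy , nearₚ , nearᵧ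
      where
      nearₚ : ∀ t → S p t → t ≡ q ⊎ t ≡ y
      nearₚ t spt with t ≟ q
      ... | yes e = inj₁ e
      ... | no ne = inj₂ (isoₚ t (spt , λ { (inj₁ (_ , e)) → ne e
                                          ; (inj₂ (e , _)) → S-irrefl spq e }))
      nearᵧ : ∀ t → S y t → t ≡ p
      nearᵧ t syt = isoᵧ t (syt , λ { (inj₁ (e , _)) → S-irrefl spy (≡.sym e)
                                    ; (inj₂ (e , _)) → q≢y (≡.sym e) })

    -- A newly isolated edge has lost a neighbour, which can only be `pq`. Hence it shares an end
    -- with `pq` and has no other neighbours.
    damage⇒stub : ∀ {p q} → S p q → Damage p q → Stub p q ⊎ Stub q p
    damage⇒stub {p} {q} spq (x , y , iso , ¬iso) with ¬isolated⇒neighbour S? (proj₁ (proj₁ iso)) ¬iso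
    ... | t , nb = oriented nb
      where
      at : ∀ x y → IsolatedIn (Without p q) x y → S x t → t ≢ y → Stub p q ⊎ Stub q p
      at x y iso@(_ , isoₓ , _) sxt t≢y
        with decidable-stable (samePair? x t p q) (λ ¬r → t≢y (isoₓ t (sxt , ¬r)))
      ... | inj₁ (refl , refl) = inj₁ (isolated⇒stub spq t≢y iso)
      ... | inj₂ (refl , refl) = inj₂ (isolated⇒stub (S-sym spq) t≢y (without-flip iso))
      oriented : (S x t × t ≢ y) ⊎ (S y t × t ≢ x) → Stub p q ⊎ Stub q p
      oriented (inj₁ (s , ne)) = at x y iso s ne
      oriented (inj₂ (s , ne)) = at y x (isolatedIn-swap without-sym iso) s ne

    undamaged : ∀ {u v w} → S u w → w ≢ v → ¬ Damage u w → Detachable S u v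
    undamaged {u} {v} {w} s w≢v ¬d = record
      { w = w ; R = λ x y → SamePair x y u w ; R? = λ x y → samePair? x y u w
      ; R-sym = SamePair-swap
      ; R⊆S = λ { (inj₁ (refl , refl)) → s ; (inj₂ (refl , refl)) → S-sym s }
      ; shape = inj₁ ; main = inj₁ (refl , refl) ; w≢v = w≢v
      ; keeps = λ {x} {y} iso → decidable-stable (isolatedIn? S? x y) λ ¬iso → ¬d (x , y , iso , ¬iso) }

    module AllDamaged {u v} (damaged : ∀ w → S u w → Damage u w) (same : side u ≡ side v) where

      ¬Suv : ¬ S u v
      ¬Suv s = proper s same

      -- The component of u consists of u, its neighbours and one leaf behind each of them
      -- (or is a path with centre u).
      legs : ∀ {w x} → S u w → S w x → x ≢ u → (∀ t → S w t → t ≡ u ⊎ t ≡ x) × (∀ t → S x t → t ≡ w)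
      legs {w} {x} suw swx x≢u with damage⇒stub suw (damaged w suw)
      ... | inj₂ (y , y≢u , swy , near-w , near-y) with near-w x swx
      ...   | inj₁ e = contradiction e x≢u
      ...   | inj₂ refl = near-w , near-y
      legs {w} {x} suw swx x≢u | inj₁ (y , y≢w , suy , near-u , near-y)
        with damage⇒stub suy (damaged y suy)
      ... | inj₂ (z , z≢u , syz , _) = contradiction (near-y z syz) z≢u
      ... | inj₁ (z , z≢y , suz , near-u′ , near-z) with near-u z suz
      ...   | inj₂ e = contradiction e z≢y
      ...   | inj₁ refl = contradiction (near-z x swx) x≢u

      -- By `legs`, `v` is a leaf behind `w`. Deleting both `uw` and `wv` leaves no edge at `v` or
      -- `w`, so only an edge at `u` could become isolated. Such an edge `uy` is damaged: either a
      -- leg behind `y` survives, or `w` would have to be a leaf, which `wv` excludes.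
      triangle : ∀ {w} → S u w → S w v → v ≢ u → Detachable S u v
      triangle {w} suw swv v≢u = record
        { w = w ; R = R ; R? = R?
        ; R-sym = R-sym
        ; R⊆S = λ { (inj₁ (inj₁ (refl , refl))) → suw
                  ; (inj₁ (inj₂ (refl , refl))) → S-sym suw
                  ; (inj₂ (inj₁ (refl , refl))) → S-sym swv
                  ; (inj₂ (inj₂ (refl , refl))) → swv }
        ; shape = λ r → r ; main = inj₁ (inj₁ (refl , refl)) ; w≢v = S-irrefl swv
        ; keeps = λ iso → proj₁ (proj₁ iso) , keepˡ iso , keepˡ (isolatedIn-swap rest-sym iso) }
        where
        R : Rel _
        R x y = SamePair x y u w ⊎ SamePair x y v w
        R? : ∀ x y → Dec (R x y)
        R? x y = samePair? x y u w ⊎-dec samePair? x y v w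
        R-sym : ∀ {x y} → R x y → R y x
        R-sym (inj₁ r) = inj₁ (SamePair-swap r)
        R-sym (inj₂ r) = inj₂ (SamePair-swap r)
        rest-sym : ∀ {x y} → (S ∖ R) x y → (S ∖ R) y x
        rest-sym (s , ¬r) = S-sym s , λ r → ¬r (R-sym r)
        near-w : ∀ t → S w t → t ≡ u ⊎ t ≡ v
        near-w = proj₁ (legs suw swv v≢u)
        near-v : ∀ t → S v t → t ≡ w
        near-v = proj₂ (legs suw swv v≢u)
        not-w : ∀ {y} → (S ∖ R) w y → ∀ {A : Set} → A
        not-w (swy , ¬r) with near-w _ swy
        ... | inj₁ refl = contradiction (inj₁ (inj₂ (refl , refl))) ¬r
        ... | inj₂ refl = contradiction (inj₂ (inj₂ (refl , refl))) ¬r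
        not-v : ∀ {y} → (S ∖ R) v y → ∀ {A : Set} → A
        not-v (svy , ¬r) with near-v _ svy
        ... | refl = contradiction (inj₂ (inj₁ (refl , refl))) ¬r
        not-u : ∀ {y} → IsolatedIn (S ∖ R) u y → ∀ {A : Set} → A
        not-u {y} ((suy , ¬r) , _ , near-y) with damage⇒stub suy (damaged y suy)
        ... | inj₂ (z , z≢u , syz , _) = contradiction (near-y z (syz , avoid)) z≢u
          where
          avoid : ¬ R y z
          avoid (inj₁ (inj₁ (refl , _))) = S-irrefl suy refl
          avoid (inj₁ (inj₂ (_ , refl))) = z≢u refl
          avoid (inj₂ (inj₁ (refl , _))) = ¬Suv suy
          avoid (inj₂ (inj₂ (refl , _))) = ¬r (inj₁ (inj₁ (refl , refl)))
        ... | inj₁ (z , z≢y , suz , near-u , near-z) with near-u w suw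
        ...   | inj₁ refl = contradiction (inj₁ (inj₁ (refl , refl))) ¬r
        ...   | inj₂ refl = contradiction (near-z v swv) v≢u
        keepˡ : ∀ {x y} → IsolatedIn (S ∖ R) x y → ∀ t → S x t → t ≡ y
        keepˡ {x} {y} iso@(sxy , near-x , _) t sxt with R? x t
        ... | no ¬r = near-x t (sxt , ¬r)
        ... | yes (inj₁ (inj₁ (refl , _))) = not-u iso
        ... | yes (inj₁ (inj₂ (refl , _))) = not-w sxy
        ... | yes (inj₂ (inj₁ (refl , _))) = not-v sxy
        ... | yes (inj₂ (inj₂ (refl , _))) = not-w sxy

      -- The component of `u`, provided that `u` has a neighbour; `u` itself enters as a neighbour
      -- of its neighbours.
      Near : Fin _ → Set
      Near x = ∃[ w ] (S u w × (x ≡ w ⊎ S w x))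

      near? : ∀ x → Dec (Near x)
      near? x = any? λ w → S? u w ×-dec ((x ≟ w) ⊎-dec S? w x)

      near-closed : ∀ {x y} → S x y → Near x → Near y
      near-closed sxy (w , suw , inj₁ refl) = w , suw , inj₂ sxy
      near-closed {x} {y} sxy (w , suw , inj₂ swx) with x ≟ u
      ... | yes refl = y , sxy , inj₁ refl
      ... | no x≢u   = w , suw , inj₁ (proj₂ (legs suw swx x≢u) y sxy)

      -- If `v` is outside the component of `u`, that component can be flipped. If not, `v` is no
      -- neighbour of `u`, being on the same side, so it is a leaf behind some neighbour.
      separate-or-detach : ∀ {w} → S u w → v ≢ u → Separates S u v ⊎ Detachable S u v
      separate-or-detach suw v≢u with near? v
      ... | no ¬p = inj₁ (Flip.flipped-separates S-sym side proper near? near-closed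
        (_ , suw , inj₂ (S-sym suw)) ¬p same)
      ... | yes (w , suw , inj₁ refl) = contradiction suw ¬Suv
      ... | yes (w , suw , inj₂ swv)  = inj₂ (triangle suw swv v≢u)

  -- When the given bipartition does not separate `u` and `v`, either some edge at `u` can be
  -- removed without damage, or all of them are damaged and the component of `u` is known
  -- explicitly.
  separates-or-detachable : ∀ {u v w} → S u w → u ≢ v → Separates S u v ⊎ Detachable S u v
  separates-or-detachable {u} {v} {w} suw u≢v with side u ≟ᵇ side v
  ... | no ne = inj₁ (side , proper , ne)
  ... | yes same with any? (λ w → S? u w ×-dec ¬? (damage? u w))
  ...   | yes (w , suw , ¬d) = inj₂ (undamaged suw (λ { refl → proper suw same }) ¬d)
  ...   | no none = AllDamaged.separate-or-detach
    (λ w s → decidable-stable (damage? u w) λ ¬d → none (w , s , ¬d)) same suw (λ e → u≢v (≡.sym e))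

-- Labellings of the edges by bipartite classes, and making the isolated edges a matching.

module Adjacency {n : ℕ} (G : Graph n) where

  A : Rel n
  A x y = T (adj G x y)

  A? : ∀ x y → Dec (A x y)
  A? x y = T? (adj G x y)

  A-sym : ∀ {x y} → A x y → A y x
  A-sym {x} {y} = ≡.subst T (Graph.sym G x y)

  A-irrefl : ∀ {x y} → A x y → x ≢ y
  A-irrefl a refl = irrefl G _ a

module Labellings {n : ℕ} (G : Graph n) (k : ℕ) where

  open Adjacency G public

  -- The label nothing marks the edges set aside for the arrow colouring below.
  Label : Set
  Label = Maybe (Fin k)

  Class : (Fin n → Fin n → Label) → Label → Rel n
  Class L l x y = A x y × L x y ≡ l

  class? : ∀ L l x y → Dec (Class L l x y)
  class? L l x y = A? x y ×-dec (L x y ≟ₘ l)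

  record Labelling : Set where
    field
      L      : Fin n → Fin n → Label
      L-sym  : ∀ x y → L x y ≡ L y x
      side   : Fin k → Fin n → Bool
      proper : ∀ {j x y} → Class L (just j) x y → side j x ≢ side j y

    class-sym : ∀ {l x y} → Class L l x y → Class L l y x
    class-sym {l} {x} {y} (a , e) = A-sym a , ≡.trans (L-sym y x) e

    IsolatedEdge : Rel n
    IsolatedEdge x y = ∃[ j ] IsolatedIn (Class L (just j)) x y

    isolatedEdge? : ∀ x y → Dec (IsolatedEdge x y)
    isolatedEdge? x y = any? λ j → isolatedIn? (class? L (just j)) x y

    isolatedEdge-sym : ∀ {x y} → IsolatedEdge x y → IsolatedEdge y x
    isolatedEdge-sym (j , iso) = j , isolatedIn-swap class-sym iso

    isolatedEdge⇒A : ∀ {x y} → IsolatedEdge x y → A x y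
    isolatedEdge⇒A (_ , (a , _) , _) = a

  open Labelling

  relabel : {P : Rel n} → (∀ x y → Dec (P x y)) → Label → (Fin n → Fin n → Label) → Fin n → Fin n → Label
  relabel P? l L x y with P? x y
  ... | yes _ = l
  ... | no _  = L x y

  module _ {P : Rel n} (P? : ∀ x y → Dec (P x y)) (l : Label) (L : Fin n → Fin n → Label) where

    relabel-in : ∀ {x y} → P x y → relabel P? l L x y ≡ l
    relabel-in {x} {y} p with P? x y
    ... | yes _ = refl
    ... | no ¬p = contradiction p ¬p

    relabel-out : ∀ {x y} → ¬ P x y → relabel P? l L x y ≡ L x y
    relabel-out {x} {y} ¬p with P? x y
    ... | yes p = contradiction p ¬p
    ... | no _  = refl

    relabel-sym : (∀ {x y} → P x y → P y x) → (∀ x y → L x y ≡ L y x) →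
                  ∀ x y → relabel P? l L x y ≡ relabel P? l L y x
    relabel-sym P-sym L-sym x y with P? x y | P? y x
    ... | yes _ | yes _ = refl
    ... | no _  | no _  = L-sym x y
    ... | yes p | no ¬p = contradiction (P-sym p) ¬p
    ... | no ¬p | yes p = contradiction (P-sym p) ¬p

    relabel-isolated : ∀ {j x y} → ¬ P x y →
      IsolatedIn (Class (relabel P? l L) (just j)) x y → IsolatedIn (Class L (just j) ∖ P) x y
    relabel-isolated ¬p ((a , e) , isoₓ , isoᵧ) =
      ((a , ≡.trans (≡.sym (relabel-out ¬p)) e) , ¬p) ,
      (λ z ((a , e) , ¬q) → isoₓ z (a , ≡.trans (relabel-out ¬q) e)) ,
      (λ z ((a , e) , ¬q) → isoᵧ z (a , ≡.trans (relabel-out ¬q) e))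

  setAside : (ℓ : Labelling) {P : Rel n} → (∀ x y → Dec (P x y)) → (∀ {x y} → P x y → P y x) → Labelling
  setAside ℓ {P} P? P-sym = record
    { L = relabel P? nothing (L ℓ) ; L-sym = relabel-sym P? nothing (L ℓ) P-sym (L-sym ℓ)
    ; side = side ℓ ; proper = proper′ }
    where
    proper′ : ∀ {j x y} → Class (relabel P? nothing (L ℓ)) (just j) x y → side ℓ j x ≢ side ℓ j y
    proper′ {j} {x} {y} (a , e) with P? x y
    ... | no _ = proper ℓ (a , e)
    proper′ (a , ()) | yes _

  setAside-in : ∀ ℓ {P : Rel n} (P? : ∀ x y → Dec (P x y)) (P-sym : ∀ {x y} → P x y → P y x) →
                ∀ {x y} → P x y → ¬ IsolatedEdge (setAside ℓ P? P-sym) x y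
  setAside-in ℓ P? P-sym p (j , (_ , e) , _)
    with () ← ≡.trans (≡.sym e) (relabel-in P? nothing (L ℓ) p)

  -- Within its own class `uv` has no neighbours, so no other edge loses a neighbour with it.
  isolated-removal : ∀ ℓ {u v} → IsolatedEdge ℓ u v → ∀ {j x y} →
    IsolatedIn (Class (L ℓ) (just j) ∖ λ x y → SamePair x y u v) x y → IsolatedIn (Class (L ℓ) (just j)) x y
  isolated-removal ℓ {u} {v} (i , (_ , euv) , isoᵤ , isoᵥ) {j} iso@((sxy , _) , _ , _) =
    sxy , half iso , half (isolatedIn-swap (λ (s , ¬p) → class-sym ℓ s , λ p → ¬p (SamePair-swap p)) iso)
    where
    half : ∀ {x y} → IsolatedIn (Class (L ℓ) (just j) ∖ λ x y → SamePair x y u v) x y →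
           ∀ z → Class (L ℓ) (just j) x z → z ≡ y
    half {x} {y} ((sxy , _) , isoₓ , _) z sxz with samePair? x z u v
    ... | no ¬p = isoₓ z (sxz , ¬p)
    ... | yes (inj₁ (refl , refl)) with refl ← just-unique (proj₂ sxz) euv = ≡.sym (isoᵤ _ sxy)
    ... | yes (inj₂ (refl , refl)) with refl ← just-unique (proj₂ sxz) (≡.trans (L-sym ℓ v u) euv) =
      ≡.sym (isoᵥ _ sxy)

  -- Since no isolated edge appears, a sweep never undoes earlier repairs, and the isolated edges
  -- stay inside a matching fixed beforehand.
  Mono : Labelling → Labelling → Set
  Mono ℓ ℓ′ = ∀ {x y} → IsolatedEdge ℓ′ x y → IsolatedEdge ℓ x y

  module _ (ℓ : Labelling) {u v : Fin n} (iso : IsolatedEdge ℓ u v) where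

    edge? : ∀ x y → Dec (SamePair x y u v)
    edge? x y = samePair? x y u v

    setEdgeAside : Labelling
    setEdgeAside = setAside ℓ edge? SamePair-swap

    setEdgeAside-mono : Mono ℓ setEdgeAside
    setEdgeAside-mono {x} {y} (j , i) = j , isolated-removal ℓ iso (relabel-isolated edge? nothing (L ℓ)
      (λ p → setAside-in ℓ edge? SamePair-swap p (j , i)) i)

    -- `sep` keeps class `j` bipartite when `uv` enters it, and `nb` provides a neighbour there, so
    -- that `uv` is no longer isolated.
    module Join {j : Fin k} (sep : Separates (Class (L ℓ) (just j)) u v)
                (nb : HasNeighbour (Class (L ℓ) (just j)) u v) where

      L′ : Fin n → Fin n → Label
      L′ = relabel edge? (just j) (L ℓ)

      side′ : Fin k → Fin n → Bool
      side′ i with i ≟ j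
      ... | yes _ = proj₁ sep
      ... | no _  = side ℓ i

      side′-proper : ∀ {i x y} → Class L′ (just i) x y → side′ i x ≢ side′ i y
      side′-proper {i} {x} {y} (a , e) with edge? x y | i ≟ j
      ... | no _  | yes refl = proj₁ (proj₂ sep) (a , e)
      ... | no _  | no _     = proper ℓ (a , e)
      ... | yes _ | no i≢j   = contradiction (just-unique refl (≡.sym e)) i≢j
      ... | yes (inj₁ (refl , refl)) | yes _ = proj₂ (proj₂ sep)
      ... | yes (inj₂ (refl , refl)) | yes _ = λ e → proj₂ (proj₂ sep) (≡.sym e)

      joined : Labelling
      joined = record { L = L′ ; L-sym = relabel-sym edge? (just j) (L ℓ) SamePair-swap (L-sym ℓ)
                      ; side = side′ ; proper = side′-proper }

      joined-¬isolated : ¬ IsolatedEdge joined u v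
      joined-¬isolated (i , (a , e) , isoᵤ , isoᵥ)
        with refl ← just-unique (relabel-in edge? (just j) (L ℓ) (inj₁ (refl , refl))) e = clash nb
        where
        kept : ∀ {x y} → ¬ SamePair x y u v → Class (L ℓ) (just j) x y → Class L′ (just j) x y
        kept ¬p (a , e) = a , ≡.trans (relabel-out edge? (just j) (L ℓ) ¬p) e
        u≢v : u ≢ v
        u≢v = A-irrefl (isolatedEdge⇒A ℓ iso)
        clash : ¬ HasNeighbour (Class (L ℓ) (just j)) u v
        clash (z , inj₁ (s , z≢v)) = z≢v (isoᵤ z (kept
          (λ { (inj₁ (_ , p)) → z≢v p ; (inj₂ (p , _)) → u≢v p }) s))
        clash (z , inj₂ (s , z≢u)) = z≢u (isoᵥ z (kept
          (λ { (inj₁ (p , _)) → u≢v (≡.sym p) ; (inj₂ (_ , p)) → z≢u p }) s))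

      -- Taking `uv` out of its class isolates nothing, and a class that gains an edge gains no
      -- isolated edge other than possibly `uv`, which `nb` excludes.
      joined-mono : Mono ℓ joined
      joined-mono {x} {y} (i , p) = i , isolated-removal ℓ iso (relabel-isolated edge? (just j) (L ℓ)
        (λ { (inj₁ (refl , refl)) → joined-¬isolated (i , p)
           ; (inj₂ (refl , refl)) → joined-¬isolated (isolatedEdge-sym joined (i , p)) }) p)

      joined-aside : ∀ {x y} → L′ x y ≡ nothing → L ℓ x y ≡ nothing
      joined-aside {x} {y} e with edge? x y
      ... | no _ = e
      joined-aside () | yes _

      aside-joined : ∀ {x y} → L ℓ x y ≡ nothing → L′ x y ≡ nothing
      aside-joined {x} {y} e with edge? x y
      ... | no _ = e
      ... | yes (inj₁ (refl , refl)) with () ← ≡.trans (≡.sym e) (proj₂ (proj₁ (proj₂ iso)))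
      ... | yes (inj₂ (refl , refl))
        with () ← ≡.trans (≡.sym e) (≡.trans (L-sym ℓ v u) (proj₂ (proj₁ (proj₂ iso))))

  Adjacent : Labelling → Fin n → Fin n → Set
  Adjacent ℓ x y = IsolatedEdge ℓ x y × ∃[ z ] (z ≢ y × IsolatedEdge ℓ x z)

  -- An edge isolated in its class can be flipped there on its own, which lets an adjacent edge join it.
  separates-isolated : ∀ ℓ {j u v z} → IsolatedIn (Class (L ℓ) (just j)) u z → v ≢ u → v ≢ z →
                       Separates (Class (L ℓ) (just j)) u v
  separates-isolated ℓ {j} {u} {v} {z} (_ , isoᵤ , isoz) v≢u v≢z with side ℓ j u ≟ᵇ side ℓ j v
  ... | no ne    = side ℓ j , proper ℓ , ne
  ... | yes same = Flip.flipped-separates (class-sym ℓ) (side ℓ j) (proper ℓ)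
                     (λ x → (x ≟ u) ⊎-dec (x ≟ z)) closed (inj₁ refl)
                     (λ { (inj₁ p) → v≢u p ; (inj₂ p) → v≢z p }) same
    where
    closed : ∀ {x y} → Class (L ℓ) (just j) x y → x ≡ u ⊎ x ≡ z → y ≡ u ⊎ y ≡ z
    closed s (inj₁ refl) = inj₂ (isoᵤ _ s)
    closed s (inj₂ refl) = inj₁ (isoz _ s)

  Total : Labelling → Set
  Total ℓ = ∀ {x y} → ¬ Class (L ℓ) nothing x y

  -- An isolated edge `uv` joins the class of an isolated edge `uz`. Running over ordered pairs
  -- treats both ends of every edge.
  separateIsolated : Σ Labelling Total → Σ (Σ Labelling Total) λ (ℓ , _) → ∀ x y → ¬ Adjacent ℓ x y
  separateIsolated = sweepPairs (λ (ℓ , _) → Adjacent ℓ) step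
    where
    adjacent? : ∀ ℓ x y → Dec (Adjacent ℓ x y)
    adjacent? ℓ x y = isolatedEdge? ℓ x y ×-dec any? λ z → ¬? (z ≟ y) ×-dec isolatedEdge? ℓ x z
    step : ∀ ((ℓ , _) : Σ Labelling Total) u v →
           Σ (Σ Labelling Total) λ (ℓ′ , _) → ¬ Adjacent ℓ′ u v × (∀ x y → Adjacent ℓ′ x y → Adjacent ℓ x y)
    step (ℓ , total) u v with adjacent? ℓ u v
    ... | no ¬a = (ℓ , total) , ¬a , λ _ _ a → a
    ... | yes (iso , z , z≢v , j , iso′) =
      (joined , λ (a , e) → total (a , joined-aside e))
      , (λ (i , _) → joined-¬isolated i)
      , λ _ _ (i , z , ne , i′) → joined-mono i , z , ne , joined-mono i′
      where
      v≢u : v ≢ u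
      v≢u e = A-irrefl (isolatedEdge⇒A ℓ iso) (≡.sym e)
      open Join ℓ iso (separates-isolated ℓ iso′ v≢u (λ e → z≢v (≡.sym e)))
                      (z , inj₁ (proj₁ iso′ , z≢v))

-- Systems of arrows on the edges set aside.

Hit : (Fin n → Maybe (Fin n)) → (Fin n → Bool) → Fin n → Set
Hit out main x = ∃[ a ] (out a ≡ just x × main a ≡ true)

-- The possible roles of an edge set aside: an edge of `H` with an arrow of its own, an edge of `H`
-- at which a painted arrow ends, or an edge from a tail of an arrow to its target.
data Covered (H : Rel n) (out : Fin n → Maybe (Fin n)) (main : Fin n → Bool) (x y : Fin n) : Set where
  primary   : ∀ {w} → H x y → out x ≡ just w → Covered H out main x y
  secondary : H x y → Hit out main x ⊎ Hit out main y → Covered H out main x y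
  arrow→    : out x ≡ just y → Covered H out main x y
  arrow←    : out y ≡ just x → Covered H out main x y

-- Z is the graph of edges set aside and H a matching.  An edge uv of H may carry an arrow to a
-- vertex w off uv (out u = out v = just w); the main end is the one whose edge to w is painted.
-- Contracting H, the arrows form a graph properly 2-coloured by par.
record Arrows (H Z : Rel n) : Set where
  field
    out         : Fin n → Maybe (Fin n)
    par main    : Fin n → Bool
    mate        : ∀ {x w} → out x ≡ just w →
                  ∃[ y ] (H x y × out y ≡ just w × par y ≡ par x × main y ≢ main x × Z x y)
    drawn       : ∀ {x w} → out x ≡ just w → main x ≡ true → Z x w
    off         : ∀ {x w} → out x ≡ just w → w ≢ x × ¬ H x w
    alternating : ∀ {x w w′} → out x ≡ just w → out w ≡ just w′ → par w ≢ par x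
    one-way     : ∀ {x w} → out x ≡ just w → out w ≢ just x
    cover       : ∀ {x y} → Z x y → Covered H out main x y

transport : {H Z Z′ : Rel n} → (∀ {x y} → Z x y → Z′ x y) → (Γ : Arrows H Z) →
            (∀ {x y} → Z′ x y → Covered H (Arrows.out Γ) (Arrows.main Γ) x y) → Arrows H Z′
transport f Γ cover′ = record
  { out = out ; par = par ; main = main
  ; mate = λ e → let y , h , o , p , m , z = mate e in y , h , o , p , m , f z
  ; drawn = λ e m → f (drawn e m) ; off = off ; alternating = alternating ; one-way = one-way
  ; cover = cover′ }
  where open Arrows Γ

noArrows : {H Z : Rel n} → (∀ {x y} → ¬ Z x y) → Arrows H Z
noArrows ¬Z = record
  { out = λ _ → nothing ; par = λ _ → true ; main = λ _ → true ; mate = λ () ; drawn = λ ()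
  ; off = λ () ; alternating = λ () ; one-way = λ () ; cover = λ z → contradiction z ¬Z }

module _ {H Z : Rel n} (H-sym : ∀ {x y} → H x y → H y x) (H-matching : ∀ {x y z} → H x y → H x z → y ≡ z)
         (Z-sym : ∀ {x y} → Z x y → Z y x) (Γ : Arrows H Z) where

  open Arrows Γ

  mate-target : ∀ {x y w} → out x ≡ just w → H x y → out y ≡ just w × par y ≡ par x × main y ≢ main x × Z x y
  mate-target e h with y , h′ , rest ← mate e with refl ← H-matching h h′ = rest

  -- The two tails of an arrow share the target, and one of them is main.
  hit : ∀ {x w} → out x ≡ just w → Hit out main w
  hit {x} e with main x in eq
  ... | true = x , e , eq
  ... | false with y , _ , o , _ , m , _ ← mate e = y , o , ≡.trans (¬-not m) (≡.cong not eq)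

  -- Nothing at `u` or `v` is set aside yet, so these ends neither carry an arrow nor are the target
  -- of one. After contracting `H`, the new arrow attaches a pendant vertex and closes no cycle.
  module AddArrow {u v w : Fin n} (huv : H u v) (u≢v : u ≢ v)
    (freeᵤ : ∀ {t} → ¬ Z u t) (freeᵥ : ∀ {t} → ¬ Z v t) (w≢u : w ≢ u) (w≢v : w ≢ v)
    {Z′ : Rel n} (Z⊆Z′ : ∀ {x y} → Z x y → Z′ x y) (Z′-sym : ∀ {x y} → Z′ x y → Z′ y x)
    (z′uv : Z′ u v) (z′uw : Z′ u w)
    (new : ∀ {x y} → Z′ x y → Z x y ⊎ SamePair x y u v ⊎ SamePair x y u w ⊎ SamePair x y v w) where

    End : Fin n → Set
    End x = x ≡ u ⊎ x ≡ v

    end? : ∀ x → Dec (End x)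
    end? x = (x ≟ u) ⊎-dec (x ≟ v)

    override : {C : Set} → C → C → (Fin n → C) → Fin n → C
    override cᵤ cᵥ f x with x ≟ u | x ≟ v
    ... | yes _ | _     = cᵤ
    ... | no _  | yes _ = cᵥ
    ... | no _  | no _  = f x

    override-u : {C : Set} {cᵤ cᵥ : C} {f : Fin n → C} → override cᵤ cᵥ f u ≡ cᵤ
    override-u with u ≟ u
    ... | yes _ = refl
    ... | no ne = contradiction refl ne

    override-v : {C : Set} {cᵤ cᵥ : C} {f : Fin n → C} → override cᵤ cᵥ f v ≡ cᵥ
    override-v with v ≟ u | v ≟ v
    ... | yes e | _     = contradiction (≡.sym e) u≢v
    ... | no _  | yes _ = refl
    ... | no _  | no ne = contradiction refl ne

    override-else : {C : Set} {cᵤ cᵥ : C} {f : Fin n → C} → ∀ {x} → ¬ End x → override cᵤ cᵥ f x ≡ f x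
    override-else {x = x} ¬e with x ≟ u | x ≟ v
    ... | yes e | _     = contradiction (inj₁ e) ¬e
    ... | no _  | yes e = contradiction (inj₂ e) ¬e
    ... | no _  | no _  = refl

    out′ : Fin n → Maybe (Fin n)
    out′ = override (just w) (just w) out
    par′ main′ : Fin n → Bool
    -- A pendant vertex can take the parity opposite to that of its only neighbour.
    par′  = override (not (par w)) (not (par w)) par
    -- `u` is the main end because `uw` is sure to be set aside, whereas `vw` need not be.
    main′ = override true false main

    free : ∀ {x} → End x → ∀ {t} → ¬ Z x t
    free (inj₁ refl) = freeᵤ
    free (inj₂ refl) = freeᵥ

    out-free : ∀ {x t} → out x ≡ just t → ¬ End x
    out-free e end with _ , _ , _ , _ , _ , z ← mate e = free end z

    target-free : ∀ {x t} → out x ≡ just t → ¬ End t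
    target-free e end with _ , o , m ← hit e = free end (Z-sym (drawn o m))

    out-end : ∀ {x} → End x → out′ x ≡ just w
    out-end (inj₁ refl) = override-u
    out-end (inj₂ refl) = override-v

    par-end : ∀ {x} → End x → par′ x ≡ not (par w)
    par-end (inj₁ refl) = override-u
    par-end (inj₂ refl) = override-v

    ¬end-w : ¬ End w
    ¬end-w (inj₁ e) = w≢u e
    ¬end-w (inj₂ e) = w≢v e

    out-old : ∀ {x t} → out x ≡ just t → out′ x ≡ just t
    out-old e = ≡.trans (override-else (out-free e)) e

    main-old : ∀ {x t} → out x ≡ just t → main′ x ≡ main x
    main-old e = override-else (out-free e)

    data Origin (x t : Fin n) : Set where
      fresh : End x → t ≡ w → Origin x t
      old   : ¬ End x → out x ≡ just t → Origin x t

    origin : ∀ x {t} → out′ x ≡ just t → Origin x t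
    origin x e with end? x
    ... | yes end = fresh end (just-unique e (out-end end))
    ... | no ¬end = old ¬end (≡.trans (≡.sym (override-else ¬end)) e)

    hit-old : ∀ {x} → Hit out main x → Hit out′ main′ x
    hit-old (a , o , m) = a , out-old o , ≡.trans (main-old o) m

    arrows : Arrows H Z′
    arrows = record
      { out = out′ ; par = par′ ; main = main′ ; mate = mate′ ; drawn = drawn′ ; off = off′
      ; alternating = λ {x} → alternating′ {x} ; one-way = one-way′ ; cover = cover′ }
      where
      mate′ : ∀ {x t} → out′ x ≡ just t →
              ∃[ y ] (H x y × out′ y ≡ just t × par′ y ≡ par′ x × main′ y ≢ main′ x × Z′ x y)
      mate′ {x} e with origin x e
      ... | fresh (inj₁ refl) refl = v , huv , override-v , ≡.trans override-v (≡.sym override-u)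
        , (λ m → contradiction (≡.trans (≡.sym override-v) (≡.trans m override-u)) (λ ())) , z′uv
      ... | fresh (inj₂ refl) refl = u , H-sym huv , override-u , ≡.trans override-u (≡.sym override-v)
        , (λ m → contradiction (≡.trans (≡.sym override-u) (≡.trans m override-v)) (λ ())) , Z′-sym z′uv
      ... | old ¬end o with y , h , o′ , p , m , z ← mate o =
        y , h , out-old o′ , ≡.trans (override-else (out-free o′)) (≡.trans p (≡.sym (override-else ¬end)))
        , (λ e → m (≡.trans (≡.sym (main-old o′)) (≡.trans e (main-old o)))) , Z⊆Z′ z
      drawn′ : ∀ {x t} → out′ x ≡ just t → main′ x ≡ true → Z′ x t
      drawn′ {x} e m with origin x e
      ... | fresh (inj₁ refl) refl = z′uw
      ... | fresh (inj₂ refl) refl with () ← ≡.trans (≡.sym m) override-v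
      ... | old ¬end o = Z⊆Z′ (drawn o (≡.trans (≡.sym (main-old o)) m))
      off′ : ∀ {x t} → out′ x ≡ just t → t ≢ x × ¬ H x t
      off′ {x} e with origin x e
      ... | fresh (inj₁ refl) refl = w≢u , λ h → w≢v (H-matching h huv)
      ... | fresh (inj₂ refl) refl = w≢v , λ h → w≢u (H-matching h (H-sym huv))
      ... | old _ o = off o
      alternating′ : ∀ {x t t′} → out′ x ≡ just t → out′ t ≡ just t′ → par′ t ≢ par′ x
      alternating′ {x} {t} e e′ eq with origin x e | origin t e′
      ... | fresh end refl | _ = not-¬ refl (≡.trans (≡.sym (override-else ¬end-w)) (≡.trans eq (par-end end)))
      ... | old _ o | fresh end _ = target-free o end
      ... | old ¬end o | old ¬end′ o′ =
        alternating o o′ (≡.trans (≡.sym (override-else ¬end′)) (≡.trans eq (override-else ¬end)))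
      one-way′ : ∀ {x t} → out′ x ≡ just t → out′ t ≢ just x
      one-way′ {x} {t} e e′ with origin x e | origin t e′
      ... | fresh end refl | fresh end′ _ = ¬end-w end′
      ... | fresh end refl | old _ o′ = target-free o′ end
      ... | old _ o | fresh end _ = target-free o end
      ... | old _ o | old _ o′ = one-way o o′
      cover′ : ∀ {x y} → Z′ x y → Covered H out′ main′ x y
      cover′ z with new z
      ... | inj₂ (inj₁ (inj₁ (refl , refl))) = primary huv override-u
      ... | inj₂ (inj₁ (inj₂ (refl , refl))) = primary (H-sym huv) override-v
      ... | inj₂ (inj₂ (inj₁ (inj₁ (refl , refl)))) = arrow→ override-u
      ... | inj₂ (inj₂ (inj₁ (inj₂ (refl , refl)))) = arrow← override-u
      ... | inj₂ (inj₂ (inj₂ (inj₁ (refl , refl)))) = arrow→ override-v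
      ... | inj₂ (inj₂ (inj₂ (inj₂ (refl , refl)))) = arrow← override-v
      ... | inj₁ z₀ with cover z₀
      ...   | primary h e = primary h (out-old e)
      ...   | secondary h (inj₁ t) = secondary h (inj₁ (hit-old t))
      ...   | secondary h (inj₂ t) = secondary h (inj₂ (hit-old t))
      ...   | arrow→ e = arrow→ (out-old e)
      ...   | arrow← e = arrow← (out-old e)

-- Absorbing the isolated edges of the matching.

module Absorption {n : ℕ} (G : Graph n) (k : ℕ)
  {H : Rel n} (H-sym : ∀ {x y} → H x y → H y x) (H-matching : ∀ {x y z} → H x y → H x z → y ≡ z) where

  open Labellings G k
  open Labelling

  Aside : Labelling → Rel n
  Aside ℓ = Class (L ℓ) nothing

  -- `H` stays fixed while the labelling loses isolated edges, so an edge already set aside still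
  -- belongs to the matching that the arrows refer to.
  record State : Set where
    field
      ℓ          : Labelling
      isolated⊆H : ∀ {x y} → IsolatedEdge ℓ x y → H x y
      arrows     : Arrows H (Aside ℓ)

  open State

  Bad : State → Fin n → Fin n → Set
  Bad s x y = IsolatedEdge (ℓ s) x y × HasNeighbour A x y

  Step : State → Fin n → Fin n → Set
  Step s u v = Σ State λ s′ → ¬ IsolatedEdge (ℓ s′) u v × Mono (ℓ s) (ℓ s′)

  module _ (s : State) {u v : Fin n} (iso : IsolatedEdge (ℓ s) u v) where

    open Arrows (arrows s)

    private
      Z : Rel n
      Z = Aside (ℓ s)

      huv : H u v
      huv = isolated⊆H s iso

      u≢v : u ≢ v
      u≢v = A-irrefl (isolatedEdge⇒A (ℓ s) iso)

      ¬Zuv : ¬ Z u v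
      ¬Zuv (_ , e) with () ← ≡.trans (≡.sym e) (proj₂ (proj₁ (proj₂ iso)))

      ¬Zvu : ¬ Z v u
      ¬Zvu z = ¬Zuv (class-sym (ℓ s) z)

      out-u : ∀ {w} → out u ≢ just w
      out-u e = ¬Zuv (proj₂ (proj₂ (proj₂ (mate-target H-sym H-matching (class-sym (ℓ s)) (arrows s) e huv))))

      out-v : ∀ {w} → out v ≢ just w
      out-v e = ¬Zvu (proj₂ (proj₂ (proj₂ (
        mate-target H-sym H-matching (class-sym (ℓ s)) (arrows s) e (H-sym huv)))))

      -- As `uv` still has a class, it is not set aside and carries no arrow. An edge set aside at
      -- `u` can therefore only be part of an arrow ending at `u`.
      hit-u : ∀ {t} → Z u t → Hit out main u
      hit-u z with cover z
      ... | primary _ e   = contradiction e out-u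
      ... | secondary h _ = contradiction (≡.subst (Z u) (H-matching h huv) z) ¬Zuv
      ... | arrow→ e      = contradiction e out-u
      ... | arrow← e      = hit H-sym H-matching (class-sym (ℓ s)) (arrows s) e

      hit-v : ∀ {t} → Z v t → Hit out main v
      hit-v z with cover z
      ... | primary _ e   = contradiction e out-v
      ... | secondary h _ = contradiction (≡.subst (Z v) (H-matching h (H-sym huv)) z) ¬Zvu
      ... | arrow→ e      = contradiction e out-v
      ... | arrow← e      = hit H-sym H-matching (class-sym (ℓ s)) (arrows s) e

    -- An arrow ending at `u` or `v` will satisfy `uv`, so `uv` is set aside without an arrow of its
    -- own.
    absorb-touched : Hit out main u ⊎ Hit out main v → Step s u v
    absorb-touched hits = record
      { ℓ = ℓ′ ; isolated⊆H = λ i → isolated⊆H s (setEdgeAside-mono (ℓ s) iso i)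
      ; arrows = transport grow (arrows s) cover′ }
      , setAside-in (ℓ s) (edge? (ℓ s) iso) SamePair-swap (inj₁ (refl , refl))
      , setEdgeAside-mono (ℓ s) iso
      where
      ℓ′ = setEdgeAside (ℓ s) iso
      grow : ∀ {x y} → Z x y → Aside ℓ′ x y
      grow {x} {y} (a , e) with edge? (ℓ s) iso x y
      ... | yes _ = a , refl
      ... | no _  = a , e
      cover′ : ∀ {x y} → Aside ℓ′ x y → Covered H out main x y
      cover′ {x} {y} (a , e) with edge? (ℓ s) iso x y
      ... | no _ = cover (a , e)
      ... | yes (inj₁ (refl , refl)) = secondary huv hits
      ... | yes (inj₂ (refl , refl)) = secondary (H-sym huv) (swap hits)

    absorb-join : ∀ {j z} → Class (L (ℓ s)) (just j) u z → z ≢ v →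
                  Separates (Class (L (ℓ s)) (just j)) u v → Step s u v
    absorb-join {z = z} c z≢v sep = record
      { ℓ = joined ; isolated⊆H = λ i → isolated⊆H s (joined-mono i)
      ; arrows = transport (λ (a , e) → a , aside-joined e) (arrows s)
                           (λ (a , e) → cover (a , joined-aside e)) }
      , joined-¬isolated , joined-mono
      where open Join (ℓ s) iso sep (z , inj₁ (c , z≢v))

    -- First `R` leaves class `j`. As `uv` is isolated in another class, it stays isolated there and
    -- can be set aside next, with an arrow to `w`.
    absorb-detach : ∀ {j} → proj₁ iso ≢ j → Detachable (Class (L (ℓ s)) (just j)) u v →
                    (∀ {t} → ¬ Z u t) → (∀ {t} → ¬ Z v t) → Step s u v
    absorb-detach {j} i≢j det freeᵤ freeᵥ = record
      { ℓ = ℓ₂ ; isolated⊆H = λ i → isolated⊆H s (mono₁ (setEdgeAside-mono ℓ₁ iso₁ i))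
      ; arrows = AddArrow.arrows H-sym H-matching (class-sym (ℓ s)) (arrows s) huv u≢v freeᵤ freeᵥ
          (λ e → A-irrefl (proj₁ (R⊆S main-edge)) (≡.sym e)) w≢v
          (λ z → grow₂ (grow₁ z)) (class-sym ℓ₂)
          (isolatedEdge⇒A (ℓ s) iso , relabel-in (edge? ℓ₁ iso₁) nothing (L ℓ₁) (inj₁ (refl , refl)))
          (grow₂ (proj₁ (R⊆S main-edge) , relabel-in R? nothing (L (ℓ s)) main-edge))
          new }
      , setAside-in ℓ₁ (edge? ℓ₁ iso₁) SamePair-swap (inj₁ (refl , refl))
      , (λ i → mono₁ (setEdgeAside-mono ℓ₁ iso₁ i))
      where
      open Detachable det renaming (main to main-edge)
      ℓ₁ = setAside (ℓ s) R? R-sym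
      ¬R-iso : ∀ {x y} → Class (L (ℓ s)) (just (proj₁ iso)) x y → ¬ R x y
      ¬R-iso (_ , e) r = i≢j (just-unique e (proj₂ (R⊆S r)))
      shrink₁ : ∀ {i x y} → Class (L ℓ₁) (just i) x y → Class (L (ℓ s)) (just i) x y
      shrink₁ {x = x} {y} (a , e) with R? x y
      ... | no _ = a , e
      shrink₁ (a , ()) | yes _
      iso₁ : IsolatedEdge ℓ₁ u v
      iso₁ = let i , (a , e) , p , q = iso in
        i , (a , ≡.trans (relabel-out R? nothing (L (ℓ s)) (¬R-iso (a , e))) e)
          , (λ z c → p z (shrink₁ c)) , (λ z c → q z (shrink₁ c))
      ℓ₂ = setEdgeAside ℓ₁ iso₁
      unremove : ∀ {i x y} → IsolatedIn (Class (L (ℓ s)) (just i) ∖ R) x y →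
                 IsolatedIn (Class (L (ℓ s)) (just i)) x y
      unremove {i} iso′@((c , _) , p , q) with i ≟ j
      ... | yes refl = keeps iso′
      ... | no i≢ = c , (λ z d → p z (d , λ r → i≢ (just-unique (proj₂ d) (proj₂ (R⊆S r)))))
                      , (λ z d → q z (d , λ r → i≢ (just-unique (proj₂ d) (proj₂ (R⊆S r)))))
      mono₁ : Mono (ℓ s) ℓ₁
      mono₁ (i , c) = i , unremove (relabel-isolated R? nothing (L (ℓ s))
        (λ r → setAside-in (ℓ s) R? R-sym r (i , c)) c)
      grow₁ : ∀ {x y} → Z x y → Aside ℓ₁ x y
      grow₁ {x} {y} (a , e) with R? x y
      ... | yes _ = a , refl
      ... | no _  = a , e
      grow₂ : ∀ {x y} → Aside ℓ₁ x y → Aside ℓ₂ x y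
      grow₂ {x} {y} (a , e) with edge? ℓ₁ iso₁ x y
      ... | yes _ = a , refl
      ... | no _  = a , e
      new₁ : ∀ {x y} → Aside ℓ₁ x y → Z x y ⊎ SamePair x y u w ⊎ SamePair x y v w
      new₁ {x} {y} (a , e) with R? x y
      ... | yes r = inj₂ (shape r)
      ... | no _  = inj₁ (a , e)
      new : ∀ {x y} → Aside ℓ₂ x y → Z x y ⊎ SamePair x y u v ⊎ SamePair x y u w ⊎ SamePair x y v w
      new {x} {y} (a , e) with edge? ℓ₁ iso₁ x y
      ... | yes p = inj₂ (inj₁ p)
      ... | no _ with new₁ (a , e)
      ...   | inj₁ z = inj₁ z
      ...   | inj₂ p = inj₂ (inj₂ p)

    -- If some edge at `u` or `v` is set aside, an arrow ends there. If none is, both ends are free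
    -- and `uz` has a class that `uv` can join or detach edges from.
    absorb : ∀ {z} → A u z → z ≢ v → Step s u v
    absorb {z} auz z≢v with any? (λ t → class? (L (ℓ s)) nothing u t ⊎-dec class? (L (ℓ s)) nothing v t)
    ... | yes (t , inj₁ zt) = absorb-touched (inj₁ (hit-u zt))
    ... | yes (t , inj₂ zt) = absorb-touched (inj₂ (hit-v zt))
    ... | no free with L (ℓ s) u z in eq
    ...   | nothing = contradiction (z , inj₁ (auz , eq)) free
    ...   | just j with separates-or-detachable (class? (L (ℓ s)) (just j)) (class-sym (ℓ s))
                          (side (ℓ s) j) (proper (ℓ s)) (auz , eq) u≢v
    ...     | inj₁ sep = absorb-join (auz , eq) z≢v sep
    -- In the class of `uv` itself, `uz` would be a neighbour of an isolated edge.
    ...     | inj₂ det = absorb-detach (λ { refl → z≢v (proj₁ (proj₂ (proj₂ iso)) z (auz , eq)) }) det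
                           (λ zt → free (_ , inj₁ zt)) (λ zt → free (_ , inj₂ zt))

  absorbAll : State → Σ State λ s → ∀ x y → ¬ Bad s x y
  absorbAll = sweepPairs Bad step
    where
    step : ∀ s u v → Σ State λ s′ → ¬ Bad s′ u v × (∀ x y → Bad s′ x y → Bad s x y)
    step s u v with isolatedEdge? (ℓ s) u v | hasNeighbour? A? u v
    ... | no ¬i | _     = s , (λ (i , _) → ¬i i) , λ _ _ b → b
    ... | yes _ | no ¬h = s , (λ (_ , h) → ¬h h) , λ _ _ b → b
    ... | yes i | yes (z , inj₁ (a , z≢v)) =
      let s′ , ok , mono = absorb s i a z≢v
      in s′ , (λ (i , _) → ok i) , λ _ _ (i , h) → mono i , h
    ... | yes i | yes (z , inj₂ (a , z≢u)) =
      let s′ , ok , mono = absorb s (isolatedEdge-sym (ℓ s) i) a z≢u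
      in s′ , (λ (i , _) → ok (isolatedEdge-sym (ℓ s′) i)) , λ _ _ (i , h) → mono i , h

-- Six colours for the edges set aside.

data ArrowColour : Set where
  -- `body` is for the edge of `H` that carries an arrow, `shaft` for an ordinary painted edge to
  -- the target, `tip` for a distinguished one. The Boolean is the parity of the arrow's tail for
  -- the first two, and `lower` of the target for `tip`.
  body shaft tip : Bool → ArrowColour

body-injective : ∀ {p q} → just (body p) ≡ just (body q) → p ≡ q
body-injective refl = refl

shaft-injective : ∀ {p q} → shaft p ≡ shaft q → p ≡ q
shaft-injective refl = refl

tip-injective : ∀ {p q} → tip p ≡ tip q → p ≡ q
tip-injective refl = refl

module ArrowColouring {n : ℕ} {H Z : Rel n} (H? : ∀ x y → Dec (H x y))
  (H-sym : ∀ {x y} → H x y → H y x) (H-irrefl : ∀ {x y} → H x y → x ≢ y)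
  (H-matching : ∀ {x y z} → H x y → H x z → y ≡ z)
  (Z-sym : ∀ {x y} → Z x y → Z y x) (Γ : Arrows H Z) where

  open Arrows Γ

  hit? : ∀ w a → Dec (out a ≡ just w × main a ≡ true)
  hit? w a = (out a ≟ₘ just w) ×-dec (main a ≟ᵇ true)

  hitter : Fin n → Maybe (Fin n)
  hitter w = pick (hit? w)

  -- Tells the two ends of an edge of `H` apart by the order of the vertices.
  lower : Fin n → Bool
  lower x = does (any? λ y → H? x y ×-dec (x <? y))

  lower-differs : ∀ {x y} → H x y → lower x ≢ lower y
  lower-differs {x} {y} h e with any? (λ z → H? x z ×-dec (x <? z)) | any? (λ z → H? y z ×-dec (y <? z))
  ... | yes (z , h₁ , x<z) | yes (z′ , h₂ , y<z′)
    with refl ← H-matching h h₁ | refl ← H-matching (H-sym h) h₂ = <-asym x<z y<z′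
  ... | no ¬p | no ¬q with <-cmp x y
  ...   | tri< x<y _ _ = ¬p (y , h , x<y)
  ...   | tri≈ _ x≡y _ = H-irrefl h x≡y
  ...   | tri> _ _ y<x = ¬q (x , H-sym h , y<x)

  -- If the edge of H at w has no arrow, one arrow ending at w is distinguished by the colour tip;
  -- lower keeps the tips at the two ends of that edge apart.
  tint : Fin n → Fin n → ArrowColour
  tint x w with out w | hitter w ≟ₘ just x
  ... | nothing | yes _ = tip (lower w)
  ... | nothing | no _  = shaft (par x)
  ... | just _  | _     = shaft (par x)

  tint-cases : ∀ x w → tint x w ≡ shaft (par x) ⊎ (hitter w ≡ just x × tint x w ≡ tip (lower w))
  tint-cases x w with out w | hitter w ≟ₘ just x
  ... | nothing | yes e = inj₂ (e , refl)
  ... | nothing | no _  = inj₁ refl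
  ... | just _  | _     = inj₁ refl

  tint-shaft : ∀ {x w t} → out w ≡ just t → tint x w ≡ shaft (par x)
  tint-shaft {x} {w} e with out w | hitter w ≟ₘ just x
  ... | just _  | _ = refl

  tint-tip : ∀ {x w} → out w ≡ nothing → hitter w ≡ just x → tint x w ≡ tip (lower w)
  tint-tip {x} {w} e e′ with out w | hitter w ≟ₘ just x
  ... | nothing | yes _ = refl
  ... | nothing | no ne = contradiction e′ ne

  tint≢body : ∀ {x w p} → tint x w ≢ body p
  tint≢body {x} {w} e with tint-cases x w
  ... | inj₁ e′       with () ← ≡.trans (≡.sym e) e′
  ... | inj₂ (_ , e′) with () ← ≡.trans (≡.sym e) e′

  data View (x y : Fin n) (m : Maybe ArrowColour) : Set where
    is-primary : ∀ {w} → H x y → out x ≡ just w → m ≡ just (body (par x)) → View x y m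
    is-second  : H x y → out x ≡ nothing → m ≡ nothing → View x y m
    is-arrow→  : ¬ H x y → out x ≡ just y → main x ≡ true → m ≡ just (tint x y) → View x y m
    is-arrow←  : ¬ H x y → out y ≡ just x → main y ≡ true → m ≡ just (tint y x) → View x y m
    is-bare    : ¬ H x y → ¬ (out x ≡ just y × main x ≡ true) → ¬ (out y ≡ just x × main y ≡ true) →
                 m ≡ nothing → View x y m

  paint : ∀ x y → ∃ (View x y)
  paint x y with H? x y
  ... | yes h with out x in e
  ...   | just w  = _ , is-primary h e refl
  ...   | nothing = _ , is-second h e refl
  paint x y | no ¬h with hit? y x | hit? x y
  ...   | yes (e , m) | _ = _ , is-arrow→ ¬h e m refl
  ...   | no _  | yes (e , m) = _ , is-arrow← ¬h e m refl
  ...   | no ¬p | no ¬q = _ , is-bare ¬h ¬p ¬q refl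

  c : Fin n → Fin n → Maybe ArrowColour
  c x y = proj₁ (paint x y)

  view : ∀ x y → View x y (c x y)
  view x y = proj₂ (paint x y)

  mate′ : ∀ {x y w} → out x ≡ just w → H x y → out y ≡ just w × par y ≡ par x × main y ≢ main x × Z x y
  mate′ = mate-target H-sym H-matching Z-sym Γ

  nothing≢just : {A : Set} {m : Maybe A} {x : A} → m ≡ nothing → m ≢ just x
  nothing≢just refl ()

  c-primary : ∀ {x y w} → H x y → out x ≡ just w → c x y ≡ just (body (par x))
  c-primary {x} {y} h e with view x y
  ... | is-primary _ _ eq = eq
  ... | is-second _ e′ _  = contradiction e (nothing≢just e′)
  ... | is-arrow→ ¬h _ _ _ = contradiction h ¬h
  ... | is-arrow← ¬h _ _ _ = contradiction h ¬h
  ... | is-bare ¬h _ _ _   = contradiction h ¬h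

  c-second : ∀ {x y} → H x y → out x ≡ nothing → c x y ≡ nothing
  c-second {x} {y} h e with view x y
  ... | is-primary _ e′ _ = contradiction e′ (nothing≢just e)
  ... | is-second _ _ eq  = eq
  ... | is-arrow→ ¬h _ _ _ = contradiction h ¬h
  ... | is-arrow← ¬h _ _ _ = contradiction h ¬h
  ... | is-bare ¬h _ _ _   = contradiction h ¬h

  c-arrow→ : ∀ {x y} → out x ≡ just y → main x ≡ true → c x y ≡ just (tint x y)
  c-arrow→ {x} {y} e m with view x y
  ... | is-primary h _ _  = contradiction h (proj₂ (off e))
  ... | is-second h _ _   = contradiction h (proj₂ (off e))
  ... | is-arrow→ _ _ _ eq = eq
  ... | is-arrow← _ e′ _ _ = contradiction e′ (one-way e)
  ... | is-bare _ ¬p _ _   = contradiction (e , m) ¬p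

  c-arrow← : ∀ {x y} → out y ≡ just x → main y ≡ true → c x y ≡ just (tint y x)
  c-arrow← {x} {y} e m with view x y
  ... | is-primary h _ _  = contradiction (H-sym h) (proj₂ (off e))
  ... | is-second h _ _   = contradiction (H-sym h) (proj₂ (off e))
  ... | is-arrow→ _ e′ _ _ = contradiction e′ (one-way e)
  ... | is-arrow← _ _ _ eq = eq
  ... | is-bare _ _ ¬q _   = contradiction (e , m) ¬q

  out-mate-nothing : ∀ {x y} → H x y → out x ≡ nothing → out y ≡ nothing
  out-mate-nothing {x} {y} h e with out y in e′
  ... | nothing = refl
  ... | just w  = contradiction (proj₁ (mate′ e′ (H-sym h))) (nothing≢just e)

  c-sym : ∀ x y → c x y ≡ c y x
  c-sym x y with view x y
  ... | is-primary h e eq = let e′ , p , _ = mate′ e h in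
    ≡.trans eq (≡.sym (≡.trans (c-primary (H-sym h) e′) (≡.cong (λ b → just (body b)) p)))
  ... | is-second h e eq = ≡.trans eq (≡.sym (c-second (H-sym h) (out-mate-nothing h e)))
  ... | is-arrow→ _ e m eq = ≡.trans eq (≡.sym (c-arrow← e m))
  ... | is-arrow← _ e m eq = ≡.trans eq (≡.sym (c-arrow→ e m))
  ... | is-bare ¬h ¬p ¬q eq with view y x
  ...   | is-primary h _ _    = contradiction (H-sym h) ¬h
  ...   | is-second h _ _     = contradiction (H-sym h) ¬h
  ...   | is-arrow→ _ e m _   = contradiction (e , m) ¬q
  ...   | is-arrow← _ e m _   = contradiction (e , m) ¬p
  ...   | is-bare _ _ _ eq′   = ≡.trans eq (≡.sym eq′)

  SatisfiedAside : Rel n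
  SatisfiedAside = SatisfiedIn Z c

  -- The witness is the edge of `H` at the tail `x`. Only one edge of `H` meets `x`, and if the one
  -- at `y` has a `body` colour, its parity is the opposite one. The edge `xy` itself may be
  -- unpainted.
  satisfied-arrow : ∀ {x y} → out x ≡ just y → SatisfiedAside x y
  satisfied-arrow {x} {y} e with mate e
  ... | m , h , e′ , p , _ , z = record
    { a = x ; b = m ; colour = body (par x) ; shared = inj₁ refl ; edge = z
    ; other = λ { (inj₁ (_ , refl)) → proj₂ (off e) h ; (inj₂ (x≡y , _)) → proj₁ (off e) (≡.sym x≡y) }
    ; painted = c-primary h e
    ; unique = unique }
    where
    unique : ∀ a b → a ≡ x ⊎ a ≡ y → Z a b → c a b ≡ just (body (par x)) → SamePair a b x m
    unique a b sh zab eq with view a b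
    ... | is-second _ _ eq′    = contradiction eq (nothing≢just eq′)
    ... | is-bare _ _ _ eq′    = contradiction eq (nothing≢just eq′)
    ... | is-arrow→ _ _ _ eq′  = contradiction (just-unique eq′ eq) tint≢body
    ... | is-arrow← _ _ _ eq′  = contradiction (just-unique eq′ eq) tint≢body
    ... | is-primary h′ e″ eq′ with sh
    ...   | inj₁ refl = inj₁ (refl , H-matching h′ h)
    ...   | inj₂ refl = contradiction (body-injective (≡.trans (≡.sym eq′) eq)) (alternating e e″)

  -- The witness is the painted edge `xw`. The other tail has no painted edge to `w`, and arrows
  -- ending at `x` or `y` are shafts of the opposite parity, because these ends carry an arrow
  -- themselves.
  satisfied-main : ∀ {x y w} → H x y → out x ≡ just w → main x ≡ true → SatisfiedAside x y
  satisfied-main {x} {y} {w} h e m with mate′ e h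
  ... | e′ , p , m≢ , _ = record
    { a = x ; b = w ; colour = tint x w ; shared = inj₁ refl ; edge = drawn e m
    ; other = λ { (inj₁ (_ , refl)) → proj₂ (off e) h ; (inj₂ (_ , w≡x)) → proj₁ (off e) w≡x }
    ; painted = c-arrow→ e m
    ; unique = unique }
    where
    ends : ∀ {a} → a ≡ x ⊎ a ≡ y → out a ≡ just w × par a ≡ par x
    ends (inj₁ refl) = e , refl
    ends (inj₂ refl) = e′ , p
    unique : ∀ a b → a ≡ x ⊎ a ≡ y → Z a b → c a b ≡ just (tint x w) → SamePair a b x w
    unique a b sh zab eq with view a b
    ... | is-second _ _ eq′  = contradiction eq (nothing≢just eq′)
    ... | is-bare _ _ _ eq′  = contradiction eq (nothing≢just eq′)
    ... | is-primary _ _ eq′ = contradiction (just-unique eq eq′) tint≢body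
    unique a b (inj₁ refl) zab eq | is-arrow→ _ e″ _ _ = inj₁ (refl , just-unique e″ e)
    unique a b (inj₂ refl) zab eq | is-arrow→ _ _ m′ _ = contradiction (≡.trans m′ (≡.sym m)) m≢
    unique a b sh zab eq | is-arrow← _ e″ _ eq′ with ends sh | tint-cases x w
    ... | ea , pa | inj₁ s = contradiction
      (≡.trans pa (shaft-injective (≡.trans (≡.sym s) (≡.trans (just-unique eq eq′) (tint-shaft ea)))))
      (alternating e″ ea)
    ... | ea , pa | inj₂ (_ , t)
      with () ← ≡.trans (≡.sym t) (≡.trans (just-unique eq eq′) (tint-shaft ea))

  satisfied-primary : ∀ {x y w} → H x y → out x ≡ just w → SatisfiedAside x y
  satisfied-primary {x} {y} h e with main x in m
  ... | true  = satisfied-main h e m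
  ... | false = let e′ , _ , m≢ , _ = mate′ e h in
    satisfiedIn-swap (satisfied-main (H-sym h) e′ (≡.trans (¬-not m≢) (≡.cong not m)))

  -- Neither end carries an arrow, so one arrow ending at `x` is coloured with a `tip`. There is one
  -- `tip` at `x`, and any at `y` differs in `lower`.
  satisfied-second : ∀ {x y} → H x y → out x ≡ nothing → Hit out main x → SatisfiedAside x y
  satisfied-second {x} {y} h e (_ , hx) with pick-complete (hit? x) hx
  ... | t , ht with pick-sound (hit? x) ht
  ... | e′ , m = record
    { a = x ; b = t ; colour = tip (lower x) ; shared = inj₁ refl ; edge = Z-sym (drawn e′ m)
    ; other = λ { (inj₁ (_ , refl)) → nothing≢just (out-mate-nothing h e) e′
                ; (inj₂ (x≡y , _)) → H-irrefl h x≡y }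
    ; painted = ≡.trans (c-arrow← e′ m) (≡.cong just (tint-tip e ht))
    ; unique = unique }
    where
    ends : ∀ {a w} → a ≡ x ⊎ a ≡ y → out a ≢ just w
    ends (inj₁ refl) = nothing≢just e
    ends (inj₂ refl) = nothing≢just (out-mate-nothing h e)
    unique : ∀ a b → a ≡ x ⊎ a ≡ y → Z a b → c a b ≡ just (tip (lower x)) → SamePair a b x t
    unique a b sh zab eq with view a b
    ... | is-second _ _ eq′  = contradiction eq (nothing≢just eq′)
    ... | is-bare _ _ _ eq′  = contradiction eq (nothing≢just eq′)
    ... | is-primary _ e″ _  = contradiction e″ (ends sh)
    ... | is-arrow→ _ e″ _ _ = contradiction e″ (ends sh)
    ... | is-arrow← _ _ _ eq′ with tint-cases b a
    ...   | inj₁ s with () ← ≡.trans (≡.sym s) (just-unique eq′ eq)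
    unique a b (inj₁ refl) zab eq | is-arrow← _ _ _ _   | inj₂ (hb , _) = inj₁ (refl , just-unique hb ht)
    unique a b (inj₂ refl) zab eq | is-arrow← _ _ _ eq′ | inj₂ (_ , s) =
      contradiction (tip-injective (≡.trans (≡.sym (just-unique eq′ eq)) s)) (lower-differs h)

  satisfied : ∀ {x y} → Z x y → SatisfiedAside x y
  satisfied {x} z with cover z
  ... | primary h e = satisfied-primary h e
  ... | arrow→ e    = satisfied-arrow e
  ... | arrow← e    = satisfiedIn-swap (satisfied-arrow e)
  ... | secondary h hits with out x in e | hits
  ...   | just _  | _      = satisfied-primary h e
  ...   | nothing | inj₁ t = satisfied-second h e t
  ...   | nothing | inj₂ t = satisfiedIn-swap (satisfied-second (H-sym h) (out-mate-nothing h e) t)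

-- Binary codes and the first bit in which they differ.

n≤2^⌈log₂n⌉ : ∀ n → n ≤ 2 ^ ⌈log₂ n ⌉
n≤2^⌈log₂n⌉ = <-rec _ step
  where
  step : ∀ n → (∀ {m} → m ℕ.< n → m ≤ 2 ^ ⌈log₂ m ⌉) → n ≤ 2 ^ ⌈log₂ n ⌉
  step zero          _   = z≤n
  step (suc zero)    _   = s≤s z≤n
  step n@(suc (suc m)) rec = begin
    n                            ≡⟨ ℕ.⌊n/2⌋+⌈n/2⌉≡n n ⟨
    ⌊ n /2⌋ + ⌈ n /2⌉            ≤⟨ ℕ.+-monoˡ-≤ ⌈ n /2⌉ (ℕ.⌊n/2⌋≤⌈n/2⌉ n) ⟩
    ⌈ n /2⌉ + ⌈ n /2⌉            ≡⟨ ≡.cong (⌈ n /2⌉ +_) (≡.sym (ℕ.+-identityʳ _)) ⟩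
    2 * ⌈ n /2⌉                  ≤⟨ ℕ.*-monoʳ-≤ 2 (rec (ℕ.⌈n/2⌉<n m)) ⟩
    2 ^ suc ⌈log₂ ⌈ n /2⌉ ⌉      ≡⟨ ≡.cong (λ l → 2 ^ suc l) (⌈log₂⌈n/2⌉⌉≡⌈log₂n⌉∸1 n) ⟩
    -- The truncated subtraction is exact, since the logarithm is at least 1 for `n` at least 2.
    2 ^ suc (⌈log₂ n ⌉ ∸ 1)      ≡⟨ ≡.cong (2 ^_) (ℕ.m+[n∸m]≡n (⌈log₂⌉-mono-≤ {2} {n} (s≤s (s≤s z≤n)))) ⟩
    2 ^ ⌈log₂ n ⌉                ∎
    where open ℕ.≤-Reasoning

funToFin-cong : ∀ {m n} {f g : Fin m → Fin n} → (∀ i → f i ≡ g i) → funToFin f ≡ funToFin g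
funToFin-cong {zero}  eq = refl
funToFin-cong {suc m} eq = ≡.cong₂ combine (eq 0F) (funToFin-cong (λ i → eq (suc i)))

finToFun-injective : ∀ {m n} {x y : Fin (n ^ m)} → (∀ i → finToFun {n} {m} x i ≡ finToFun y i) → x ≡ y
finToFun-injective {m} {n} {x} {y} eq = ≡.trans (≡.sym (funToFin-finToFin {m} {n} x))
  (≡.trans (funToFin-cong {m} {n} eq) (funToFin-finToFin {m} {n} y))

isZero : Fin 2 → Bool
isZero 0F = true
isZero 1F = false

isZero-injective : ∀ {x y} → isZero x ≡ isZero y → x ≡ y
isZero-injective {0F} {0F} _ = refl
isZero-injective {1F} {1F} _ = refl
isZero-injective {0F} {1F} ()
isZero-injective {1F} {0F} ()

firstDifference : ∀ {k} → (f g : Fin k → Bool) → Maybe (Fin k)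
firstDifference {zero}  f g = nothing
firstDifference {suc k} f g with f 0F ≟ᵇ g 0F
... | no _  = just 0F
... | yes _ = Maybe.map suc (firstDifference (λ i → f (suc i)) (λ i → g (suc i)))

firstDifference-sym : ∀ {k} (f g : Fin k → Bool) → firstDifference f g ≡ firstDifference g f
firstDifference-sym {zero}  f g = refl
firstDifference-sym {suc k} f g with f 0F ≟ᵇ g 0F | g 0F ≟ᵇ f 0F
... | no _  | no _  = refl
... | yes e | no ne = contradiction (≡.sym e) ne
... | no ne | yes e = contradiction (≡.sym e) ne
... | yes _ | yes _ = ≡.cong (Maybe.map suc) (firstDifference-sym (λ i → f (suc i)) (λ i → g (suc i)))

firstDifference-just : ∀ {k} (f g : Fin k → Bool) {j} → firstDifference f g ≡ just j → f j ≢ g j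
firstDifference-just {suc k} f g eq with f 0F ≟ᵇ g 0F
firstDifference-just {suc k} f g refl | no ne = ne
... | yes _ with firstDifference (λ i → f (suc i)) (λ i → g (suc i)) in eq′
firstDifference-just {suc k} f g refl | yes _ | just j = firstDifference-just _ _ eq′

firstDifference-nothing : ∀ {k} (f g : Fin k → Bool) → firstDifference f g ≡ nothing → ∀ j → f j ≡ g j
firstDifference-nothing {suc k} f g eq j with f 0F ≟ᵇ g 0F
... | yes e with firstDifference (λ i → f (suc i)) (λ i → g (suc i)) in eq′
firstDifference-nothing {suc k} f g eq zero    | yes e | nothing = e
firstDifference-nothing {suc k} f g eq (suc j) | yes e | nothing = firstDifference-nothing _ _ eq′ j

-- Encoding the palette by numbers.

code : ArrowColour → Fin 16
code (body false)  = 0F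
code (body true)   = 1F
code (shaft false) = 2F
code (shaft true)  = 3F
code (tip false)   = 4F
code (tip true)    = 5F

decode : Fin 16 → ArrowColour
decode 0F = body false
decode 1F = body true
decode 2F = shaft false
decode 3F = shaft true
decode 4F = tip false
-- Values outside the image of `code` are sent here too; `decode` only has to be a left inverse.
decode _  = tip true

decode-code : ∀ a → decode (code a) ≡ a
decode-code (body false)  = refl
decode-code (body true)   = refl
decode-code (shaft false) = refl
decode-code (shaft true)  = refl
decode-code (tip false)   = refl
decode-code (tip true)    = refl

Palette : ℕ → Set
Palette k = (Fin 3 × Fin k) ⊎ ArrowColour

encode : ∀ {k} → Palette k → Fin (3 * k + 16)
encode {k} p = join (3 * k) 16 (Sum.map (uncurry combine) code p)

encode-injective : ∀ {k} {p q : Palette k} → encode p ≡ encode q → p ≡ q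
encode-injective {k} {p} {q} eq = cases p q
  (≡.trans (≡.sym (splitAt-join (3 * k) 16 (Sum.map (uncurry combine) code p)))
  (≡.trans (≡.cong (splitAt (3 * k)) eq) (splitAt-join (3 * k) 16 (Sum.map (uncurry combine) code q))))
  where
  cases : ∀ p q → Sum.map (uncurry combine) code p ≡ Sum.map (uncurry combine) code q → p ≡ q
  cases (inj₁ (i , j)) (inj₁ (i′ , j′)) e with combine-injective i j i′ j′ (inj₁-injective e)
  ... | refl , refl = refl
  cases (inj₂ a) (inj₂ b) e = ≡.cong inj₂ (≡.trans (≡.sym (decode-code a))
    (≡.trans (≡.cong decode (inj₂-injective e)) (decode-code b)))

-- Passing from colourings of vertex pairs to colourings of edges.

module _ {n : ℕ} {G : Graph n} where

  open Adjacency G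

  edgeOf : ∀ {x y} → A x y → Σ (Edge G) λ e → SamePair (src {G = G} e) (tgt {G = G} e) x y
  edgeOf {x} {y} a with <-cmp x y
  ... | tri< x<y _ _ = (x , y , x<y , a) , inj₁ (refl , refl)
  ... | tri≈ _ refl _ = contradiction refl (A-irrefl a)
  ... | tri> _ _ y<x = (y , x , y<x , A-sym a) , inj₂ (refl , refl)

  -- Both edges list their ends in increasing order, which rules out opposite orientations.
  samePair⇒sameEdge : ∀ (e f : Edge G) {a b} → SamePair (src {G = G} e) (tgt {G = G} e) a b →
                      SamePair (src {G = G} f) (tgt {G = G} f) a b → SameEdge {G = G} e f
  samePair⇒sameEdge _ _ (inj₁ (refl , refl)) (inj₁ (refl , refl)) = refl , refl
  samePair⇒sameEdge _ _ (inj₂ (refl , refl)) (inj₂ (refl , refl)) = refl , refl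
  samePair⇒sameEdge (_ , _ , lt , _) (_ , _ , lt′ , _) (inj₁ (refl , refl)) (inj₂ (refl , refl)) =
    contradiction lt′ (<-asym lt)
  samePair⇒sameEdge (_ , _ , lt , _) (_ , _ , lt′ , _) (inj₂ (refl , refl)) (inj₁ (refl , refl)) =
    contradiction lt′ (<-asym lt)

  neighbour : ∀ (e : Edge G) → ¬ Isolated {G = G} e → HasNeighbour A (src {G = G} e) (tgt {G = G} e)
  neighbour e@(u , v , u<v , a) ¬iso with hasNeighbour? A? u v
  ... | yes h = h
  ... | no ¬h = contradiction isolated ¬iso
    where
    isolated : Isolated {G = G} e
    isolated ((x , y , x<y , a′) , inj₁ (inj₁ refl) , ne) = ¬h (y , inj₁ (a′ , λ { refl → ne (refl , refl) }))
    isolated ((x , y , x<y , a′) , inj₁ (inj₂ refl) , ne) = ¬h (x , inj₁ (A-sym a′ , λ { refl → <-asym u<v x<y }))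
    isolated ((x , y , x<y , a′) , inj₂ (inj₁ refl) , ne) = ¬h (y , inj₂ (a′ , λ { refl → <-asym u<v x<y }))
    isolated ((x , y , x<y , a′) , inj₂ (inj₂ refl) , ne) = ¬h (x , inj₂ (A-sym a′ , λ { refl → ne (refl , refl) }))

  module _ {C : Set} {m : ℕ} (paint : Fin n → Fin n → Maybe C)
    (paint-sym : ∀ {x y} → A x y → paint x y ≡ paint y x)
    (enc : C → Fin m) (enc-injective : ∀ {p q} → enc p ≡ enc q → p ≡ q) where

    colouring : PartialEdgeColouring G m
    colouring e = Maybe.map enc (paint (src {G = G} e) (tgt {G = G} e))

    satisfiedIn⇒satisfied : ∀ (e : Edge G) → SatisfiedIn A paint (src {G = G} e) (tgt {G = G} e) →
                            Satisfied {G = G} colouring e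
    satisfiedIn⇒satisfied e@(u , v , u<v , _) sat with edgeOf (SatisfiedIn.edge sat)
    ... | e′ , same = enc colour , e′ , (touches , λ { (refl , refl) → other (flip-pair same) })
                    , ≡.cong (Maybe.map enc) (paint-pair same) , only
      where
      open SatisfiedIn sat
      flip-pair : ∀ {x y} → SamePair x y a b → SamePair a b x y
      flip-pair (inj₁ (refl , refl)) = inj₁ (refl , refl)
      flip-pair (inj₂ (refl , refl)) = inj₂ (refl , refl)
      a∈e′ : _∈ᵥ_ {G = G} a e′
      a∈e′ = Sum.map (λ (p , _) → ≡.sym p) (λ (_ , p) → ≡.sym p) same
      touches : InClosedNbhd {G = G} e e′
      touches = Sum.map (λ p → ≡.subst (λ z → _∈ᵥ_ {G = G} z e′) p a∈e′)
                        (λ p → ≡.subst (λ z → _∈ᵥ_ {G = G} z e′) p a∈e′) shared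
      paint-pair : ∀ {x y} → SamePair x y a b → paint x y ≡ just colour
      paint-pair (inj₁ (refl , refl)) = painted
      paint-pair (inj₂ (refl , refl)) = ≡.trans (paint-sym (A-sym edge)) painted
      uncolour : ∀ {x : Maybe C} → Maybe.map enc x ≡ just (enc colour) → x ≡ just colour
      uncolour {just _} eq = ≡.cong just (enc-injective (just-injective eq))
      only : ∀ f → InClosedNbhd {G = G} e f → colouring f ≡ just (enc colour) → SameEdge {G = G} f e′
      only f@(x , y , _ , axy) cl eq = samePair⇒sameEdge f e′ (near cl) same
        where
        pxy = uncolour eq
        pyx = ≡.trans (paint-sym (A-sym axy)) pxy
        near : InClosedNbhd {G = G} e f → SamePair x y a b
        -- `unique` expects the shared end first, so `f` is reversed when it meets `e` in its larger
        -- end.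
        near (inj₁ (inj₁ u≡x)) = unique x y (inj₁ (≡.sym u≡x)) axy pxy
        near (inj₁ (inj₂ u≡y)) = SamePair-swap (unique y x (inj₁ (≡.sym u≡y)) (A-sym axy) pyx)
        near (inj₂ (inj₁ v≡x)) = unique x y (inj₂ (≡.sym v≡x)) axy pxy
        near (inj₂ (inj₂ v≡y)) = SamePair-swap (unique y x (inj₂ (≡.sym v≡y)) (A-sym axy) pyx)

map-just⁻ : ∀ {A B : Set} (f : A → B) m {b} → Maybe.map f m ≡ just b → ∃[ a ] (m ≡ just a × f a ≡ b)
map-just⁻ f (just a) refl = a , refl , refl

-- Combining the colourings of the classes with the arrow colouring.

module Painting {n : ℕ} (G : Graph n) (k : ℕ) {H : Rel n} (H? : ∀ x y → Dec (H x y))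
  (H-sym : ∀ {x y} → H x y → H y x) (H-irrefl : ∀ {x y} → H x y → x ≢ y)
  (H-matching : ∀ {x y z} → H x y → H x z → y ≡ z)
  (s : Absorption.State G k H-sym H-matching)
  (done : ∀ x y → ¬ Absorption.Bad G k H-sym H-matching s x y) where

  open Labellings G k
  open Absorption G k H-sym H-matching
  open Labelling
  open State s renaming (ℓ to ℓ₂)

  module Z = ArrowColouring {H = H} {Z = Aside ℓ₂} H? H-sym H-irrefl H-matching
    (class-sym ℓ₂) arrows

  classColouring = λ j → bipartite-colouring (Class (L ℓ₂) (just j)) (class? (L ℓ₂) (just j)) (class-sym ℓ₂)
                                             (side ℓ₂ j) (proper ℓ₂)

  -- Every colour records the class it belongs to, so colours of different classes never clash, and
  -- uniqueness within a class is uniqueness in `G`.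
  paintAs : Label → Fin n → Fin n → Maybe (Palette k)
  paintAs (just j) x y = Maybe.map (λ i → inj₁ (i , j)) (proj₁ (classColouring j) x y)
  paintAs nothing  x y = Maybe.map inj₂ (Z.c x y)

  paint : Fin n → Fin n → Maybe (Palette k)
  paint x y = paintAs (L ℓ₂ x y) x y

  paint-sym : ∀ {x y} → A x y → paint x y ≡ paint y x
  paint-sym {x} {y} a = ≡.trans (by-label (L ℓ₂ x y) refl) (≡.cong (λ l → paintAs l y x) (L-sym ℓ₂ x y))
    where
    by-label : ∀ l → L ℓ₂ x y ≡ l → paintAs l x y ≡ paintAs l y x
    by-label (just j) e = ≡.cong (Maybe.map _) (proj₁ (proj₂ (classColouring j)) (a , e))
    by-label nothing  e = ≡.cong (Maybe.map _) (Z.c-sym x y)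

  paintAs-class : ∀ l {x y i j} → paintAs l x y ≡ just (inj₁ (i , j)) →
                  l ≡ just j × proj₁ (classColouring j) x y ≡ just i
  paintAs-class (just j) {x} {y} e with map-just⁻ _ (proj₁ (classColouring j) x y) e
  ... | _ , eq , refl = refl , eq
  paintAs-class nothing  {x} {y} e with map-just⁻ _ (Z.c x y) e
  ... | _ , _ , ()

  paintAs-aside : ∀ l {x y a} → paintAs l x y ≡ just (inj₂ a) → l ≡ nothing × Z.c x y ≡ just a
  paintAs-aside (just j) {x} {y} e with map-just⁻ _ (proj₁ (classColouring j) x y) e
  ... | _ , _ , ()
  paintAs-aside nothing  {x} {y} e with map-just⁻ _ (Z.c x y) e
  ... | _ , eq , refl = refl , eq

  satisfied : ∀ {x y} → A x y → HasNeighbour A x y → SatisfiedIn A paint x y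
  satisfied {x} {y} axy nb with L ℓ₂ x y in eq
  ... | nothing = record
    { a = a ; b = b ; colour = inj₂ colour ; shared = shared ; edge = proj₁ edge ; other = other
    ; painted = ≡.trans (≡.cong (λ l → paintAs l a b) (proj₂ edge)) (≡.cong (Maybe.map inj₂) painted)
    ; unique = λ a′ b′ sh s e → let e₁ , e₂ = paintAs-aside (L ℓ₂ a′ b′) e in unique a′ b′ sh (s , e₁) e₂ }
    where open SatisfiedIn (Z.satisfied (axy , eq))
  ... | just j = record
    { a = a ; b = b ; colour = inj₁ (colour , j) ; shared = shared ; edge = proj₁ edge ; other = other
    ; painted = ≡.trans (≡.cong (λ l → paintAs l a b) (proj₂ edge)) (≡.cong (Maybe.map _) painted)
    ; unique = λ a′ b′ sh s e → let e₁ , e₂ = paintAs-class (L ℓ₂ a′ b′) e in unique a′ b′ sh (s , e₁) e₂ }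
    where
    open SatisfiedIn (proj₂ (proj₂ (classColouring j)) (axy , eq)
      -- An edge isolated in its class although it has a neighbour in `G` would still be bad.
      (¬isolated⇒neighbour (class? (L ℓ₂) (just j)) (axy , eq) λ i → done x y ((j , i) , nb)))

-- The initial labelling and the final assembly.

module Assembly {n α : ℕ} (G : Graph n) (χ : Fin n → Fin α)
  (χ-proper : ∀ u v → T (adj G u v) → ¬ (χ u ≡ χ v)) where

  k : ℕ
  k = ⌈log₂ α ⌉

  open Labellings G k
  open Labelling

  -- The binary digits of the vertex colour, seen as a number below `2 ^ k`.
  bit : Fin n → Fin k → Bool
  bit v j = isZero (finToFun {2} {k} (inject≤ (χ v) (n≤2^⌈log₂n⌉ α)) j)

  bit-injective : ∀ {u v} → (∀ j → bit u j ≡ bit v j) → χ u ≡ χ v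
  bit-injective {u} {v} eq = inject≤-injective (n≤2^⌈log₂n⌉ α) (n≤2^⌈log₂n⌉ α) (χ u) (χ v)
    (finToFun-injective {k} {2} λ j → isZero-injective (eq j))

  -- Digit `j` itself is a bipartition of class `j`. Every edge gets a class because adjacent
  -- vertices have different codes.
  initial : Σ Labelling Total
  initial = record
    { L = λ x y → firstDifference (bit x) (bit y)
    ; L-sym = λ x y → firstDifference-sym (bit x) (bit y)
    ; side = λ j v → bit v j
    ; proper = λ {j} {x} {y} (_ , e) → firstDifference-just (bit x) (bit y) e }
    , λ {x} {y} (a , e) → χ-proper x y a (bit-injective (firstDifference-nothing (bit x) (bit y) e))

  Result : Set
  Result = ∃[ paint ] ((∀ {x y} → A x y → paint x y ≡ paint y x) ×
    (∀ {x y} → A x y → HasNeighbour A x y → SatisfiedIn {C = Palette k} A paint x y))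

  -- The matching `H` is the set of edges isolated at this stage. No edge is set aside yet, so
  -- absorption starts without arrows.
  fromTotal : (Σ (Σ Labelling Total) λ (ℓ , _) → ∀ x y → ¬ Adjacent ℓ x y) → Result
  fromTotal ((ℓ , total) , none) =
    fromState (absorbAll record { ℓ = ℓ ; isolated⊆H = λ i → i ; arrows = noArrows total })
    where
    H-matching : ∀ {x y z} → IsolatedEdge ℓ x y → IsolatedEdge ℓ x z → y ≡ z
    H-matching {x} {y} {z} h h′ = decidable-stable (y ≟ z) λ y≢z →
      none x y (h , z , (λ e → y≢z (≡.sym e)) , h′)
    open Absorption G k (isolatedEdge-sym ℓ) H-matching
    fromState : (Σ State λ s → ∀ x y → ¬ Bad s x y) → Result
    fromState (s , done) = paint , (λ {x} {y} → paint-sym {x} {y}) , λ {x} {y} → satisfied {x} {y}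
      where
      H-irrefl : ∀ {x y} → IsolatedEdge ℓ x y → x ≢ y
      H-irrefl h = A-irrefl (isolatedEdge⇒A ℓ h)
      open Painting G k (isolatedEdge? ℓ) (isolatedEdge-sym ℓ) H-irrefl H-matching s done

  abstract
    result : Result
    result = fromTotal (separateIsolated initial)

theorem12 : (α : ℕ) → α ≥ 1 → (n : ℕ) → (G : Graph n) → ChromaticAtMost G α →
    Σ (PartialEdgeColouring G (3 * ⌈log₂ α ⌉ + 16)) λ c →
    (∀ e → ¬ Isolated {G = G} e → Satisfied {G = G} c e)
theorem12 α _ n G (χ , χ-proper) =
  let paint , paint-sym , satisfied = Assembly.result G χ χ-proper
      enc = encode {⌈log₂ α ⌉}
  in colouring {G = G} paint paint-sym enc encode-injective
   , λ e@(_ , _ , _ , a) ¬iso → satisfiedIn⇒satisfied {G = G} paint paint-sym enc encode-injective e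
       (satisfied a (neighbour {G = G} e ¬iso))
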